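{- Let $1\le k\le d-1$ be integers. If $d-k$ is even, then $$n(k,d)\le \max\left\{\sum_{j=0}^{k}\binom{d}{j},\ \sum_{j=1}^{\frac{d-k-2}{2}}\left(\frac{1}{2^{j+1}}-\frac{1}{2^{d-k-j}}\right)\left|B_{k+2j}^{(d)}\right|+2^{\frac{d+k}{2}}\right\}.$$ If $d-k$ is odd, then $$n(k,d)\le \max\left\{\sum_{j=0}^{k}\binom{d}{j},\ \sum_{j=1}^{\frac{d-k-3}{2}}\left(\frac{1}{2^{j+1}}-\frac{1}{2^{d-k-j}}\right)\left|B_{k+2j}^{(d)}\right|+\frac{1}{2^{\frac{d-k+1}{2}}}\left|B_{d-1}^{(d)}\right|+2^{\frac{d+k-1}{2}}\right\}.$$
   Context: A standard box in $\mathbb{R}^d$ is a set $K=K_1\times\cdots\times K_d$ where each $K_i\subseteq\mathbb{R}$ is a closed interval. A finite family of $d$-dimensional standard boxes in $\mathbb{R}^d$ is called $k$-neighborly if the dimension of the intersection of any two distinct members is in $\{d-k,d-k+1,\ldots,d-1\}$ (in particular the intersection is nonempty). For positive integers $1\le k\le d$, $n(k,d)$ is the maximum number of members of a $k$-neighborly family of $d$-dimensional standard boxes in $\mathbb{R}^d$. For a nonnegative integer $m\le d-1$, the configuration $B_m^{(d)}\subseteq\{0,1\}^d$ is defined as follows: if $m=2t$, it is the set of binary vectors of length $d$ with at most $t$ coordinates equal to $1$; if $m=2t+1$, it is the Cartesian product of $\{0,1\}$ with the set of binary vectors of length $d-1$ with at most $t$ coordinates equal to $1$. Thus $|B_m^{(d)}|=\sum_{i=0}^{t}\binom{d}{i}$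 if $m=2t$, and $|B_m^{(d)}|=2\sum_{i=0}^{t}\binom{d-1}{i}$ if $m=2t+1$. Empty sums (upper limit smaller than the lower limit) equal $0$. -}

module Defs where

open import Data.Bool using (Bool; true; false; _≟_)
open import Data.Fin using (Fin)
open import Data.Integer using (+_)
open import Data.List using (List; []; _∷_; cartesianProductWith; filter; length)
open import Data.Nat as ℕ using (ℕ; zero; suc)
open import Data.Nat.DivMod using (_%_; _/_)
open import Data.Nat.Properties using (m^n≢0)
open import Data.Product using (Σ; ∃; _×_)
open import Data.Rational as ℚ using (ℚ; 0ℚ)
open import Data.Sum using (_⊎_)
open import Data.Vec as Vec using (Vec; count; sum; tabulate)
open import Level using (0ℓ)
open import Relation.Binary.PropositionalEquality using (_≡_; _≢_)
open import Relation.Nullary using (¬_)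
open import Relation.Unary using (Pred; _∩_; _≐_)

-- Two-sided Dedekind cuts. The order is all that standard boxes need, so no
-- arithmetic on ℝ is developed; equality of reals is _≤ᴿ_ in both directions.
record ℝ : Set₁ where
  field
    L U         : ℚ → Set
    L-inhabited : ∃ L
    U-inhabited : ∃ U
    L-closed    : ∀ {q r} → q ℚ.< r → L r → L q
    L-open      : ∀ {q} → L q → ∃ λ r → q ℚ.< r × L r
    U-closed    : ∀ {q r} → q ℚ.< r → U q → U r
    U-open      : ∀ {r} → U r → ∃ λ q → q ℚ.< r × U q
    disjoint    : ∀ {q} → ¬ (L q × U q)
    located     : ∀ {q r} → q ℚ.< r → L q ⊎ U r

infix 4 _≤ᴿ_ _<ᴿ_

_≤ᴿ_ : ℝ → ℝ → Set
x ≤ᴿ y = ∀ q → ℝ.L x q → ℝ.L y q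

_<ᴿ_ : ℝ → ℝ → Set
x <ᴿ y = ∃ λ q → ℝ.U x q × ℝ.L y q

record Interval : Set₁ where
  field
    lo hi : ℝ
    lo≤hi : lo ≤ᴿ hi
open Interval public

data IntervalDim (I : Interval) : ℕ → Set where
  point         : hi I ≤ᴿ lo I → IntervalDim I 0
  nondegenerate : lo I <ᴿ hi I → IntervalDim I 1

Point : ℕ → Set₁
Point d = Fin d → ℝ

Box : ℕ → Set₁
Box d = Fin d → Interval

⟦_⟧ : ∀ {d} → Box d → Pred (Point d) 0ℓ
⟦ K ⟧ x = ∀ i → lo (K i) ≤ᴿ x i × x i ≤ᴿ hi (K i)

BoxDim : ∀ {d} → Box d → ℕ → Set
BoxDim {d} K n = Σ (Fin d → ℕ) λ e →
  (∀ i → IntervalDim (K i) (e i)) × sum (tabulate e) ≡ n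

-- Dimension is needed only for boxes and for intersections of two boxes; a
-- nonempty intersection of boxes is again a (possibly degenerate) box. The empty
-- set has no dimension in this sense.
Dim : ∀ {d} → Pred (Point d) 0ℓ → ℕ → Set₁
Dim {d} S n = Σ (Box d) λ M → S ≐ ⟦ M ⟧ × BoxDim M n

-- Indexing by Fin N does not admit repeated members: equal boxes would meet in
-- a set of dimension d.
record IsNeighborly (k : ℕ) {d N : ℕ} (F : Fin N → Box d) : Set₁ where
  field
    full-dimensional : ∀ i → Dim ⟦ F i ⟧ d
    intersections    : ∀ i j → i ≢ j →
      Σ ℕ λ m → Dim (⟦ F i ⟧ ∩ ⟦ F j ⟧) m × d ℕ.∸ k ℕ.≤ m × m ℕ.< d

-- n(k,d) ≤ q. Since n(k,d) is the maximum of the sizes of k-neighborly families,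
-- this says that q bounds every such size.
n⟨_,_⟩≤_ : ℕ → ℕ → ℚ → Set₁
n⟨ k , d ⟩≤ q = ∀ N (F : Fin N → Box d) → IsNeighborly k F → + N ℚ./ 1 ℚ.≤ q

binaryVectors : ∀ d → List (Vec Bool d)
binaryVectors zero    = Vec.[] ∷ []
binaryVectors (suc d) = cartesianProductWith Vec._∷_ (false ∷ true ∷ []) (binaryVectors d)

atMostOnes : ℕ → ∀ d → List (Vec Bool d)
atMostOnes t d = filter (λ v → count (_≟ true) v ℕ.≤? t) (binaryVectors d)

-- First argument: the parity of m; second: t = ⌊m/2⌋. The case of odd m and
-- d = 0 is a junk value, excluded by m ≤ d - 1.
configuration : ℕ → ℕ → ∀ d → List (Vec Bool d)
configuration zero    t d       = atMostOnes t d
configuration (suc _) t zero    = []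
configuration (suc _) t (suc d) =
  cartesianProductWith Vec._∷_ (false ∷ true ∷ []) (atMostOnes t d)

-- The lists enumerate without repetition, so length is cardinality.
B : (m d : ℕ) → List (Vec Bool d)
B m d = configuration (m % 2) (m / 2) d

∣B∣ : (m d : ℕ) → ℚ
∣B∣ m d = + length (B m d) ℚ./ 1

2^_ : ℕ → ℚ
2^ n = + (2 ℕ.^ n) ℚ./ 1

1/2^_ : ℕ → ℚ
1/2^ n = ℚ._/_ (+ 1) (2 ℕ.^ n) {{m^n≢0 2 n}}

-- f 1 + ⋯ + f n
∑₁ : ℕ → (ℕ → ℚ) → ℚ
∑₁ zero    f = 0ℚ
∑₁ (suc n) f = ∑₁ n f ℚ.+ f (suc n)

-- f 0 + ⋯ + f n
∑₀ : ℕ → (ℕ → ℚ) → ℚ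
∑₀ n f = f 0 ℚ.+ ∑₁ n f

infix  9 2^_ 1/2^_
infix  4 n⟨_,_⟩≤_

{-# OPTIONS --safe #-}

-- A neighborly family of boxes is encoded by words over {0,1,∗}: in each coordinate all
-- intervals share a point, and a box gets 0 or 1 if its interval ends or starts where it
-- touches another one, ∗ otherwise. Two words then clash in between 1 and k positions, so
-- the subcubes they describe are disjoint. If some word is free of ∗, the others are
-- determined by their sets of clashes with it, whence the sum of binomial coefficients.
-- Otherwise let S(j) be the volume of the union of the subcubes with at most j stars. It has
-- diameter at most k+2j, so Kleitman's theorem bounds S(j); and the layers j and d-k-1-j are
-- at distance less than d, so that the antipode of one is disjoint from the other and
-- S(j) + S(d-k-1-j) ≤ 2ᵈ. Summation by parts gives N ≤ ∑ S(j)/2ʲ⁺¹, and the bound follows.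
--
-- Kleitman's theorem is proved by induction on the dimension. Compressing the family (first
-- towards 0 in the first coordinate, then by trading (1,u) for (0,u′) with u′ a neighbour of
-- u) preserves size and diameter ≤ s, and makes the section at 1 have diameter ≤ s-2.
module Submission where

open import Defs

-- Families of binary vectors and their cardinality.

module Hypercube where
  open import Data.Bool as Bool using (Bool; true; false; not; _∧_; _∨_; _xor_; if_then_else_)
  open import Data.Bool.Properties using (∧-comm; ∨-zeroʳ; xor-comm; not-involutive)
  open import Data.Empty using (⊥-elim)
  open import Data.Fin using (Fin; zero; suc)
  open import Data.List using (List; []; _∷_; length; filter; map; _++_; allFin)
  open import Data.List.Membership.Propositional using (_∈_)
  open import Data.List.Membership.Propositional.Properties using (∈-allFin)
  open import Data.List.Properties using (length-++; length-map; filter-++; ++-identityʳ)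
  open import Data.List.Relation.Unary.Any using (here; there)
  open import Data.Nat
  open import Data.Nat.DivMod using (_%_; m≡m%n+[m/n]*n; m%n<n; +-distrib-/-∣ˡ)
  open import Data.Nat.Divisibility using (∣-refl)
  open import Data.Nat.Properties
  open import Data.Nat.Tactic.RingSolver using (solve-∀)
  open import Data.Product using (∃; ∃₂; _×_; _,_; proj₁; proj₂)
  open import Data.Sum using (_⊎_; inj₁; inj₂)
  open import Data.Vec as Vec using (Vec; []; _∷_; updateAt; count)
  open import Function using (_∘_; case_of_)
  open import Relation.Binary.PropositionalEquality
  open import Relation.Nullary using (¬_; does; yes; no)
  open import Relation.Unary using (Pred; Decidable)

  Cube : ℕ → Set
  Cube n = Vec Bool n

  Family : ℕ → Set
  Family n = Cube n → Bool

  infix 4 _∈ᶠ_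

  _∈ᶠ_ : ∀ {n} → Cube n → Family n → Set
  v ∈ᶠ f = f v ≡ true

  infixr 6 _∩ᶠ_
  infixr 5 _∪ᶠ_

  _∪ᶠ_ _∩ᶠ_ : ∀ {n} → Family n → Family n → Family n
  (f ∪ᶠ g) v = f v ∨ g v
  (f ∩ᶠ g) v = f v ∧ g v

  ∨-true : ∀ {a b} → a ∨ b ≡ true → a ≡ true ⊎ b ≡ true
  ∨-true {true}  _ = inj₁ refl
  ∨-true {false} p = inj₂ p

  ∨-trueˡ : ∀ {a b} → a ≡ true → a ∨ b ≡ true
  ∨-trueˡ refl = refl

  ∨-trueʳ : ∀ {a b} → b ≡ true → a ∨ b ≡ true
  ∨-trueʳ {a} refl = ∨-zeroʳ a

  ∧-true : ∀ {a b} → a ∧ b ≡ true → a ≡ true × b ≡ true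
  ∧-true {true} p = refl , p

  ⟦_⟧ᵇ : Bool → ℕ
  ⟦ b ⟧ᵇ = if b then 1 else 0

  card : ∀ {n} → Family n → ℕ
  card {zero}  f = ⟦ f [] ⟧ᵇ
  card {suc n} f = card (f ∘ (false ∷_)) + card (f ∘ (true ∷_))

  card-cong : ∀ {n} {f g : Family n} → (∀ v → f v ≡ g v) → card f ≡ card g
  card-cong {zero}  eq = cong ⟦_⟧ᵇ (eq [])
  card-cong {suc n} eq = cong₂ _+_ (card-cong (eq ∘ (false ∷_))) (card-cong (eq ∘ (true ∷_)))

  card-mono : ∀ {n} {f g : Family n} → (∀ v → v ∈ᶠ f → v ∈ᶠ g) → card f ≤ card g
  card-mono {zero}  {f} {g} f⊆g with f [] in eq
  ... | false = z≤n
  ... | true  = ≤-reflexive (cong ⟦_⟧ᵇ (sym (f⊆g [] eq)))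
  card-mono {suc n} f⊆g =
    +-mono-≤ (card-mono (f⊆g ∘ (false ∷_))) (card-mono (f⊆g ∘ (true ∷_)))

  card-empty : ∀ {n} {f : Family n} → (∀ v → ¬ v ∈ᶠ f) → card f ≡ 0
  card-empty {zero}  {f} f⊆∅ with f [] in eq
  ... | false = refl
  ... | true  = ⊥-elim (f⊆∅ [] eq)
  card-empty {suc n} f⊆∅ =
    cong₂ _+_ (card-empty (f⊆∅ ∘ (false ∷_))) (card-empty (f⊆∅ ∘ (true ∷_)))

  card-full : ∀ {n} → card {n} (λ _ → true) ≡ 2 ^ n
  card-full {zero}  = refl
  card-full {suc n} =
    trans (cong₂ _+_ (card-full {n}) (card-full {n})) (cong (2 ^ n +_) (sym (+-identityʳ (2 ^ n))))

  card≤2^n : ∀ {n} (f : Family n) → card f ≤ 2 ^ n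
  card≤2^n {n} f = ≤-trans (card-mono {f = f} (λ _ _ → refl)) (≤-reflexive (card-full {n}))

  interchange : ∀ a b c d → (a + b) + (c + d) ≡ (a + c) + (b + d)
  interchange = solve-∀

  -- Both compressions below replace the two sections of a family by a union and an intersection,
  -- and this identity keeps the size unchanged. It also yields additivity on disjoint families.
  card-∪∩ : ∀ {n} (f g : Family n) → card (f ∪ᶠ g) + card (f ∩ᶠ g) ≡ card f + card g
  card-∪∩ {zero}  f g with f [] | g []
  ... | false | b     = +-identityʳ ⟦ b ⟧ᵇ
  ... | true  | false = refl
  ... | true  | true  = refl
  card-∪∩ {suc n} f g =
    trans (interchange (card (f₀ ∪ᶠ g₀)) (card (f₁ ∪ᶠ g₁)) (card (f₀ ∩ᶠ g₀)) (card (f₁ ∩ᶠ g₁)))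
    (trans (cong₂ _+_ (card-∪∩ f₀ g₀) (card-∪∩ f₁ g₁))
           (interchange (card f₀) (card g₀) (card f₁) (card g₁)))
    where
    f₀ = f ∘ (false ∷_)
    f₁ = f ∘ (true ∷_)
    g₀ = g ∘ (false ∷_)
    g₁ = g ∘ (true ∷_)

  card-⊎ : ∀ {n} (f g : Family n) → (∀ v → v ∈ᶠ f → ¬ v ∈ᶠ g) →
           card (f ∪ᶠ g) ≡ card f + card g
  card-⊎ f g disj = begin
    card (f ∪ᶠ g)                  ≡⟨ sym (+-identityʳ _) ⟩
    card (f ∪ᶠ g) + 0              ≡⟨ cong (card (f ∪ᶠ g) +_) (sym (card-empty {f = f ∩ᶠ g}
                                        λ v p → disj v (proj₁ (∧-true p)) (proj₂ (∧-true {f v} p)))) ⟩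
    card (f ∪ᶠ g) + card (f ∩ᶠ g)  ≡⟨ card-∪∩ f g ⟩
    card f + card g                ∎
    where open ≡-Reasoning

  card-∪≤ : ∀ {n} (f g : Family n) → card (f ∪ᶠ g) ≤ card f + card g
  card-∪≤ f g = ≤-trans (m≤m+n _ _) (≤-reflexive (card-∪∩ f g))

  disjoint-card : ∀ {n} (f g : Family n) → (∀ v → v ∈ᶠ f → ¬ v ∈ᶠ g) → card f + card g ≤ 2 ^ n
  disjoint-card f g disj = subst (_≤ _) (card-⊎ f g disj) (card≤2^n (f ∪ᶠ g))

  -- Coordinate flips, antipodes and Hamming distance.

  flip : ∀ {n} → Fin n → Cube n → Cube n
  flip x v = updateAt v x not

  flip-involutive : ∀ {n} (x : Fin n) v → flip x (flip x v) ≡ v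
  flip-involutive zero    (b ∷ v) = cong (_∷ v) (not-involutive b)
  flip-involutive (suc x) (b ∷ v) = cong (b ∷_) (flip-involutive x v)

  card-flip : ∀ {n} (x : Fin n) (f : Family n) → card (f ∘ flip x) ≡ card f
  card-flip zero    f = +-comm (card (f ∘ (true ∷_))) (card (f ∘ (false ∷_)))
  card-flip (suc x) f = cong₂ _+_ (card-flip x (f ∘ (false ∷_))) (card-flip x (f ∘ (true ∷_)))

  antipode : ∀ {n} → Cube n → Cube n
  antipode = Vec.map not

  card-antipode : ∀ {n} (f : Family n) → card (f ∘ antipode) ≡ card f
  card-antipode {zero}  f = refl
  card-antipode {suc n} f =
    trans (cong₂ _+_ (card-antipode (f ∘ (true ∷_))) (card-antipode (f ∘ (false ∷_))))
          (+-comm (card (f ∘ (true ∷_))) (card (f ∘ (false ∷_))))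

  dist : ∀ {n} → Cube n → Cube n → ℕ
  dist []      []      = 0
  dist (a ∷ u) (b ∷ v) = ⟦ a xor b ⟧ᵇ + dist u v

  dist-sym : ∀ {n} (u v : Cube n) → dist u v ≡ dist v u
  dist-sym []      []      = refl
  dist-sym (a ∷ u) (b ∷ v) = cong₂ _+_ (cong ⟦_⟧ᵇ (xor-comm a b)) (dist-sym u v)

  dist-antipode : ∀ {n} (v : Cube n) → dist (antipode v) v ≡ n
  dist-antipode []          = refl
  dist-antipode (true ∷ v)  = cong suc (dist-antipode v)
  dist-antipode (false ∷ v) = cong suc (dist-antipode v)

  dist-flip : ∀ {n} (x : Fin n) u v → dist (flip x u) v ≤ suc (dist u v)
  dist-flip zero    (true ∷ u)  (true ∷ v)  = ≤-refl
  dist-flip zero    (true ∷ u)  (false ∷ v) = m≤n+m _ 2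
  dist-flip zero    (false ∷ u) (true ∷ v)  = m≤n+m _ 2
  dist-flip zero    (false ∷ u) (false ∷ v) = ≤-refl
  dist-flip (suc x) (a ∷ u)     (b ∷ v)     =
    ≤-trans (+-monoʳ-≤ ⟦ a xor b ⟧ᵇ (dist-flip x u v)) (≤-reflexive (+-suc ⟦ a xor b ⟧ᵇ _))

  dist-flipʳ : ∀ {n} (x : Fin n) u v → dist u (flip x v) ≡ dist (flip x u) v
  dist-flipʳ zero    (true ∷ u)  (true ∷ v)  = refl
  dist-flipʳ zero    (true ∷ u)  (false ∷ v) = refl
  dist-flipʳ zero    (false ∷ u) (true ∷ v)  = refl
  dist-flipʳ zero    (false ∷ u) (false ∷ v) = refl
  dist-flipʳ (suc x) (a ∷ u)     (b ∷ v)     = cong (⟦ a xor b ⟧ᵇ +_) (dist-flipʳ x u v)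

  dist-flip₂ : ∀ {n} (x : Fin n) u v → dist (flip x u) (flip x v) ≡ dist u v
  dist-flip₂ x u v =
    trans (dist-flipʳ x (flip x u) v) (cong (λ w → dist w v) (flip-involutive x u))

  -- A distance below `n` leaves a coordinate in which the vectors agree, and that one is flipped.
  -- In `second-half` this produces a pair that is too far apart.
  farther-flip : ∀ {n} (u v : Cube n) → dist u v < n → ∃ λ x → dist (flip x u) v ≡ suc (dist u v)
  farther-flip []          []          ()
  farther-flip (true ∷ u)  (true ∷ v)  _ = zero , refl
  farther-flip (false ∷ u) (false ∷ v) _ = zero , refl
  farther-flip (true ∷ u)  (false ∷ v) (s≤s d<n) with farther-flip u v d<n
  ... | x , eq = suc x , cong suc eq
  farther-flip (false ∷ u) (true ∷ v)  (s≤s d<n) with farther-flip u v d<n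
  ... | x , eq = suc x , cong suc eq

  -- Compression of families of bounded diameter.

  Diameter≤ : ∀ {n} → ℕ → Family n → Set
  Diameter≤ s f = ∀ u v → u ∈ᶠ f → v ∈ᶠ f → dist u v ≤ s

  -- f₀ and f₁ are the sections at first coordinate 0 and 1 of a family compressed towards 0.
  record Halves {n} (s : ℕ) (f₀ f₁ : Family n) : Set where
    field
      nested : ∀ v → v ∈ᶠ f₁ → v ∈ᶠ f₀
      within : Diameter≤ s f₀
      across : ∀ u v → u ∈ᶠ f₀ → v ∈ᶠ f₁ → dist u v < s

  -- Moves `true ∷ v` to `false ∷ v` wherever that place is free. A vector of the intersection has
  -- both extensions in `f`, so against any vector of the union one can be chosen that differs in
  -- the first coordinate; this makes the remaining distance strictly smaller than `s`.
  push-down : ∀ {n s} {f : Family (suc n)} → Diameter≤ s f →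
              Halves s ((f ∘ (false ∷_)) ∪ᶠ (f ∘ (true ∷_))) ((f ∘ (false ∷_)) ∩ᶠ (f ∘ (true ∷_)))
  push-down {f = f} diam = record
    { nested = λ v p → ∨-trueˡ (proj₁ (∧-true {f (false ∷ v)} p))
    ; within = λ u v p q → within′ u v (∨-true p) (∨-true q)
    ; across = λ u v p q → across′ u v (∨-true p) (∧-true q)
    }
    where
    within′ : ∀ u v → (false ∷ u) ∈ᶠ f ⊎ (true ∷ u) ∈ᶠ f → (false ∷ v) ∈ᶠ f ⊎ (true ∷ v) ∈ᶠ f →
              dist u v ≤ _
    within′ u v (inj₁ p) (inj₁ q) = diam _ _ p q
    within′ u v (inj₁ p) (inj₂ q) = ≤-trans (n≤1+n _) (diam _ _ p q)
    within′ u v (inj₂ p) (inj₁ q) = ≤-trans (n≤1+n _) (diam _ _ p q)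
    within′ u v (inj₂ p) (inj₂ q) = diam _ _ p q
    across′ : ∀ u v → (false ∷ u) ∈ᶠ f ⊎ (true ∷ u) ∈ᶠ f → (false ∷ v) ∈ᶠ f × (true ∷ v) ∈ᶠ f →
              dist u v < _
    across′ u v (inj₁ p) (_ , q) = diam _ _ p q
    across′ u v (inj₂ p) (q , _) = diam _ _ p q

  module _ {n s} (x : Fin n) {f₀ f₁ : Family n} (h : Halves s f₀ f₁) where
    open Halves h

    -- Trades `true ∷ u` for `false ∷ flip x u` wherever the latter is missing. One moved vector
    -- costs one flip, which the strict inequality of `across` pays for; for two moved vectors the
    -- flips cancel.
    shift-halves : Halves s (f₀ ∪ᶠ (f₁ ∘ flip x)) (f₁ ∩ᶠ (f₀ ∘ flip x))
    shift-halves = record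
      { nested = λ v p → ∨-trueˡ (nested v (proj₁ (∧-true p)))
      ; within = λ u v p q → within′ u v (∨-true p) (∨-true q)
      ; across = λ u v p q → across′ u v (∨-true p) (∧-true q)
      }
      where
      moved : ∀ u v → u ∈ᶠ f₀ → flip x v ∈ᶠ f₁ → dist u v ≤ s
      moved u v p q = begin
        dist u v                    ≡⟨ sym (dist-flip₂ x u v) ⟩
        dist (flip x u) (flip x v)  ≤⟨ dist-flip x u (flip x v) ⟩
        suc (dist u (flip x v))     ≤⟨ across u (flip x v) p q ⟩
        s                           ∎
        where open ≤-Reasoning
      within′ : ∀ u v → u ∈ᶠ f₀ ⊎ flip x u ∈ᶠ f₁ → v ∈ᶠ f₀ ⊎ flip x v ∈ᶠ f₁ → dist u v ≤ s
      within′ u v (inj₁ p) (inj₁ q) = within u v p q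
      within′ u v (inj₁ p) (inj₂ q) = moved u v p q
      within′ u v (inj₂ p) (inj₁ q) = subst (_≤ s) (dist-sym v u) (moved v u q p)
      within′ u v (inj₂ p) (inj₂ q) = subst (_≤ s) (dist-flip₂ x u v) (within _ _ (nested _ p) (nested _ q))
      across′ : ∀ u v → u ∈ᶠ f₀ ⊎ flip x u ∈ᶠ f₁ → v ∈ᶠ f₁ × flip x v ∈ᶠ f₀ → dist u v < s
      across′ u v (inj₁ p) (q , _) = across u v p q
      -- `v` remained only because `flip x v` is in `f₀`, so `across` applies to the flipped pair
      -- with the roles exchanged.
      across′ u v (inj₂ p) (_ , q) =
        subst (_< s) (trans (dist-sym (flip x v) (flip x u)) (dist-flip₂ x u v)) (across _ _ q p)

    -- Reindexing the intersection by `flip x` turns it into that of `f₀` and `f₁ ∘ flip x`, the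
    -- partner of the union in `card-∪∩`.
    shift-card : card (f₀ ∪ᶠ (f₁ ∘ flip x)) + card (f₁ ∩ᶠ (f₀ ∘ flip x)) ≡ card f₀ + card f₁
    shift-card = begin
      card (f₀ ∪ᶠ (f₁ ∘ flip x)) + card (f₁ ∩ᶠ (f₀ ∘ flip x))
        ≡⟨ cong (card (f₀ ∪ᶠ (f₁ ∘ flip x)) +_) (trans (sym (card-flip x _)) (card-cong swap)) ⟩
      card (f₀ ∪ᶠ (f₁ ∘ flip x)) + card (f₀ ∩ᶠ (f₁ ∘ flip x))
        ≡⟨ card-∪∩ f₀ (f₁ ∘ flip x) ⟩
      card f₀ + card (f₁ ∘ flip x)
        ≡⟨ cong (card f₀ +_) (card-flip x f₁) ⟩
      card f₀ + card f₁ ∎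
      where
      open ≡-Reasoning
      swap : ∀ v → f₁ (flip x v) ∧ f₀ (flip x (flip x v)) ≡ f₀ v ∧ f₁ (flip x v)
      swap v = trans (∧-comm (f₁ (flip x v)) _)
                     (cong (λ w → f₀ w ∧ f₁ (flip x v)) (flip-involutive x v))

  -- Shifting along one coordinate enlarges the first half and shrinks the second,
  -- hence does not destroy closure under the coordinates treated before.
  compress : ∀ {n s} (xs : List (Fin n)) {f₀ f₁ : Family n} → Halves s f₀ f₁ →
             ∃₂ λ g₀ g₁ → Halves s g₀ g₁ × card g₀ + card g₁ ≡ card f₀ + card f₁
                        × (∀ {x} → x ∈ xs → ∀ u → u ∈ᶠ g₁ → flip x u ∈ᶠ g₀)
  compress []       {f₀} {f₁} h = f₀ , f₁ , h , refl , λ ()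
  compress (x ∷ xs) {f₀} {f₁} h with compress xs h
  ... | g₀ , g₁ , h′ , eq , closed =
    g₀ ∪ᶠ (g₁ ∘ flip x) , g₁ ∩ᶠ (g₀ ∘ flip x) , shift-halves x h′ , trans (shift-card x h′) eq , closed′
    where
    closed′ : ∀ {y} → y ∈ x ∷ xs → ∀ u → u ∈ᶠ g₁ ∩ᶠ (g₀ ∘ flip x) → flip y u ∈ᶠ g₀ ∪ᶠ (g₁ ∘ flip x)
    closed′ (here refl) u p = ∨-trueˡ (proj₂ (∧-true {g₁ u} p))
    closed′ (there y∈)  u p = ∨-trueˡ (closed y∈ u (proj₁ (∧-true p)))

  -- By nestedness `across` already gives a distance below `s`. Were it exactly `s - 1`, flipping an
  -- agreeing coordinate of `u` would give a vector of `f₀` at distance `s` from `v`, contrary to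
  -- `across`. The assumption `s ≤ n` provides the agreeing coordinate.
  second-half : ∀ {n s} {f₀ f₁ : Family n} → s ≤ n → Halves s f₀ f₁ →
                (∀ x u → u ∈ᶠ f₁ → flip x u ∈ᶠ f₀) →
                ∀ u v → u ∈ᶠ f₁ → v ∈ᶠ f₁ → suc (dist u v) < s
  second-half s≤n h closed u v p q = ≤∧≢⇒< d<s λ d+1≡s →
    let x , farther = farther-flip u v (<-≤-trans d<s s≤n)
    in <-irrefl d+1≡s (subst (_< _) farther (across (flip x u) v (closed x u p) q))
    where
    open Halves h
    d<s = across u v (nested u p) q

  -- Sizes of the configurations.

  private module _ {a p} {A : Set a} {P : Pred A p} (P? : Decidable P) where
    length-filter-map : ∀ {b} {C : Set b} (g : C → A) xs →
                        length (filter P? (map g xs)) ≡ length (filter (P? ∘ g) xs)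
    length-filter-map g []       = refl
    length-filter-map g (x ∷ xs) with does (P? (g x))
    ... | true  = cong suc (length-filter-map g xs)
    ... | false = length-filter-map g xs

  -- The bridge from the lists of the statement to `card`, whose recursion on the first coordinate
  -- suits the induction.
  length-filter-binaryVectors : ∀ {n p} {P : Pred (Cube n) p} (P? : Decidable P) →
    length (filter P? (binaryVectors n)) ≡ card (does ∘ P?)
  length-filter-binaryVectors {zero}  P? with does (P? [])
  ... | true  = refl
  ... | false = refl
  length-filter-binaryVectors {suc n} P? = begin
    length (filter P? (map (false ∷_) bs ++ map (true ∷_) bs ++ []))
      ≡⟨ cong (λ l → length (filter P? (map (false ∷_) bs ++ l))) (++-identityʳ _) ⟩
    length (filter P? (map (false ∷_) bs ++ map (true ∷_) bs))
      ≡⟨ cong length (filter-++ P? (map (false ∷_) bs) _) ⟩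
    length (filter P? (map (false ∷_) bs) ++ filter P? (map (true ∷_) bs))
      ≡⟨ length-++ (filter P? (map (false ∷_) bs)) ⟩
    length (filter P? (map (false ∷_) bs)) + length (filter P? (map (true ∷_) bs))
      ≡⟨ cong₂ _+_ (length-filter-map P? (false ∷_) bs) (length-filter-map P? (true ∷_) bs) ⟩
    length (filter (P? ∘ (false ∷_)) bs) + length (filter (P? ∘ (true ∷_)) bs)
      ≡⟨ cong₂ _+_ (length-filter-binaryVectors (P? ∘ (false ∷_)))
                   (length-filter-binaryVectors (P? ∘ (true ∷_))) ⟩
    card (does ∘ P? ∘ (false ∷_)) + card (does ∘ P? ∘ (true ∷_)) ∎
    where
    open ≡-Reasoning
    bs = binaryVectors n

  ones : ∀ {n} → Cube n → ℕ
  ones = count (Bool._≟ true)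

  ≤ᵇ-true : ∀ {m n} → m ≤ n → (m ≤ᵇ n) ≡ true
  ≤ᵇ-true {m} {n} m≤n with m ≤ᵇ n | ≤⇒≤ᵇ m≤n
  ... | true | _ = refl

  ball : ℕ → ∀ n → Family n
  ball t n v = ones v ≤ᵇ t

  length-atMostOnes : ∀ t n → length (atMostOnes t n) ≡ card (ball t n)
  length-atMostOnes t n = length-filter-binaryVectors {n} (λ v → ones v ≤? t)

  card-ball-zero : ∀ n → card (ball 0 (suc n)) ≡ card (ball 0 n)
  card-ball-zero n =
    trans (cong (card (ball 0 n) +_) (card-empty {n} {λ _ → false} λ _ ())) (+-identityʳ _)

  card-ball-suc : ∀ t n → card (ball (suc t) (suc n)) ≡ card (ball (suc t) n) + card (ball t n)
  card-ball-suc t n = cong (card (ball (suc t) n) +_) (card-cong {n} λ v → lemma (ones v))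
    where
    lemma : ∀ m → (suc m ≤ᵇ suc t) ≡ (m ≤ᵇ t)
    lemma zero    = refl
    lemma (suc _) = refl

  length-configuration-odd : ∀ p t n → length (configuration (suc p) t (suc n)) ≡ 2 * card (ball t n)
  length-configuration-odd p t n = begin
    length (map (false ∷_) xs ++ map (true ∷_) xs ++ [])       ≡⟨ length-++ (map (false ∷_) xs) ⟩
    length (map (false ∷_) xs) + length (map (true ∷_) xs ++ [])
      ≡⟨ cong₂ _+_ (length-map (false ∷_) xs)
           (trans (length-++ (map (true ∷_) xs)) (cong (_+ 0) (length-map (true ∷_) xs))) ⟩
    2 * length xs                                              ≡⟨ cong (2 *_) (length-atMostOnes t n) ⟩
    2 * card (ball t n)                                        ∎
    where
    open ≡-Reasoning
    xs = atMostOnes t n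

  -- With `t = 0` the ball is a single point in every dimension. These are the cases `s = 0` and
  -- `s = 1` of the induction, where the second section is empty.
  length-configuration-zero : ∀ p n →
    length (configuration p 0 (suc (suc n))) ≡ length (configuration p 0 (suc n))
  length-configuration-zero zero    n =
    trans (length-atMostOnes 0 (suc (suc n)))
    (trans (card-ball-zero (suc n)) (sym (length-atMostOnes 0 (suc n))))
  length-configuration-zero (suc p) n =
    trans (length-configuration-odd p 0 (suc n))
    (trans (cong (2 *_) (card-ball-zero n)) (sym (length-configuration-odd p 0 n)))

  -- Pascal's rule for balls, doubled when the parity is odd. It is the recurrence of a compressed
  -- family: one section of diameter `s`, and one of diameter `s - 2`, that is with `t` lowered by
  -- one.
  length-configuration-suc : ∀ p t n →
    length (configuration p (suc t) (suc (suc n))) ≡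
    length (configuration p (suc t) (suc n)) + length (configuration p t (suc n))
  length-configuration-suc zero    t n = begin
    length (configuration zero (suc t) (suc (suc n)))  ≡⟨ length-atMostOnes (suc t) (suc (suc n)) ⟩
    card (ball (suc t) (suc (suc n)))                  ≡⟨ card-ball-suc t (suc n) ⟩
    card (ball (suc t) (suc n)) + card (ball t (suc n))
      ≡⟨ sym (cong₂ _+_ (length-atMostOnes (suc t) (suc n)) (length-atMostOnes t (suc n))) ⟩
    _ ∎
    where open ≡-Reasoning
  length-configuration-suc (suc p) t n = begin
    length (configuration (suc p) (suc t) (suc (suc n)))  ≡⟨ length-configuration-odd p (suc t) (suc n) ⟩
    2 * card (ball (suc t) (suc n))                       ≡⟨ cong (2 *_) (card-ball-suc t n) ⟩
    2 * (card (ball (suc t) n) + card (ball t n))         ≡⟨ *-distribˡ-+ 2 (card (ball (suc t) n)) _ ⟩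
    2 * card (ball (suc t) n) + 2 * card (ball t n)
      ≡⟨ sym (cong₂ _+_ (length-configuration-odd p (suc t) n) (length-configuration-odd p t n)) ⟩
    _ ∎
    where open ≡-Reasoning

  ones-antipode : ∀ {n} (v : Cube n) → ones v + ones (antipode v) ≡ n
  ones-antipode []          = refl
  ones-antipode (true ∷ v)  = cong suc (ones-antipode v)
  ones-antipode (false ∷ v) = trans (+-suc _ _) (cong suc (ones-antipode v))

  -- A vector of odd length 2t+1 or its antipode has at most t ones.
  half-ball : ∀ t → 2 ^ (t * 2) ≤ card (ball t (suc (t * 2)))
  half-ball t = *-cancelˡ-≤ 2 (begin
    2 ^ suc (t * 2)                                ≡⟨ sym (card-full {suc (t * 2)}) ⟩
    card {suc (t * 2)} (λ _ → true)                ≤⟨ card-mono {f = λ _ → true} {g = b ∪ᶠ (b ∘ antipode)}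
                                                        (λ v _ → either v) ⟩
    card (b ∪ᶠ (b ∘ antipode))                     ≤⟨ card-∪≤ b (b ∘ antipode) ⟩
    card b + card (b ∘ antipode)                   ≡⟨ cong (card b +_) (card-antipode b) ⟩
    card b + card b                                ≡⟨ cong (card b +_) (sym (+-identityʳ (card b))) ⟩
    2 * card b                                     ∎)
    where
    open ≤-Reasoning
    b = ball t (suc (t * 2))
    either : ∀ v → v ∈ᶠ b ∪ᶠ (b ∘ antipode)
    either v with ones v ≤? t
    ... | yes p = ∨-trueˡ (≤ᵇ-true p)
    ... | no  p = ∨-trueʳ (≤ᵇ-true (+-cancelˡ-≤ (suc t) _ _ (begin
      suc t + ones (antipode v)   ≤⟨ +-monoˡ-≤ _ (≰⇒> p) ⟩
      ones v + ones (antipode v)  ≡⟨ ones-antipode v ⟩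
      suc (t * 2)                 ≡⟨ cong suc (*-comm t 2) ⟩
      suc (t + (t + 0))           ≡⟨ cong (λ m → suc (t + m)) (+-identityʳ t) ⟩
      suc t + t                   ∎)))

  -- Serves the case of a diameter one below the dimension, where antipodes bound a family by half
  -- the cube. For odd `n` the free first coordinate doubles a half ball of one dimension less.
  half-configuration : ∀ n → 2 ^ n ≤ length (B n (suc n))
  half-configuration n with n % 2 | n / 2 | m≡m%n+[m/n]*n n 2 | m%n<n n 2
  ... | zero        | t | refl | _ =
    ≤-trans (half-ball t) (≤-reflexive (sym (length-atMostOnes t (suc (t * 2)))))
  ... | suc zero    | t | refl | _ =
    ≤-trans (*-monoʳ-≤ 2 (half-ball t)) (≤-reflexive (sym (length-configuration-odd 0 t (suc (t * 2)))))
  ... | suc (suc _) | _ | _    | s≤s (s≤s ())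

  -- Kleitman's theorem, by induction on the dimension.

  antipodal-bound : ∀ {n} {f : Family (suc n)} → Diameter≤ n f → card f ≤ 2 ^ n
  antipodal-bound {n} {f} diam = *-cancelˡ-≤ 2 (begin
    2 * card f                    ≡⟨ cong (card f +_) (+-identityʳ (card f)) ⟩
    card f + card f               ≡⟨ cong (card f +_) (sym (card-antipode f)) ⟩
    -- A vector in both families would be at distance `n + 1` from its antipode, which lies in `f`
    -- too.
    card f + card (f ∘ antipode)  ≤⟨ disjoint-card f (f ∘ antipode) (λ v p q →
                                       1+n≰n (subst (_≤ n) (dist-antipode v) (diam _ _ q p))) ⟩
    2 ^ suc n                     ∎)
    where open ≤-Reasoning

  B-suc : ∀ s n → length (B (2 + s) (suc (suc n))) ≡ length (B (2 + s) (suc n)) + length (B s (suc n))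
  B-suc s n rewrite +-distrib-/-∣ˡ {2} s {2} ∣-refl = length-configuration-suc (s % 2) (s / 2) n

  module _ (n : ℕ) (bounded : ∀ s {f : Family (suc n)} → s < suc n → Diameter≤ s f →
                              card f ≤ length (B s (suc n))) where

    private
      first-half-only : ∀ s (g₀ : Family (suc n)) {g₁ : Family (suc n)} →
        length (B s (suc (suc n))) ≡ length (B s (suc n)) → card g₀ ≤ length (B s (suc n)) →
        (∀ v → ¬ v ∈ᶠ g₁) → card g₀ + card g₁ ≤ length (B s (suc (suc n)))
      first-half-only s g₀ {g₁} same g₀≤ g₁⊆∅ = begin
        card g₀ + card g₁           ≡⟨ cong (card g₀ +_) (card-empty g₁⊆∅) ⟩
        card g₀ + 0                 ≡⟨ +-identityʳ _ ⟩
        card g₀                     ≤⟨ g₀≤ ⟩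
        length (B s (suc n))        ≡⟨ sym same ⟩
        length (B s (suc (suc n)))  ∎
        where open ≤-Reasoning

    -- For `s ≥ 2` the induction hypothesis is used twice, with diameters `s` and `s - 2`. For
    -- `s ≤ 1` the second section is empty, since a vector of it paired with itself violates the
    -- strict bound.
    halves-bound : ∀ s {g₀ g₁ : Family (suc n)} → s < suc n → Halves s g₀ g₁ →
                   (∀ u v → u ∈ᶠ g₁ → v ∈ᶠ g₁ → suc (dist u v) < s) →
                   card g₀ + card g₁ ≤ length (B s (suc (suc n)))
    halves-bound (suc (suc s)) {g₀} {g₁} s<n h close = begin
      card g₀ + card g₁
        ≤⟨ +-mono-≤ (bounded (suc (suc s)) s<n (Halves.within h))
             (bounded s (<-trans (n<1+n s) (<-trans (n<1+n (suc s)) s<n))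
               λ u v p q → ≤-pred (≤-pred (close u v p q))) ⟩
      length (B (suc (suc s)) (suc n)) + length (B s (suc n))  ≡⟨ sym (B-suc s n) ⟩
      length (B (suc (suc s)) (suc (suc n)))                   ∎
      where open ≤-Reasoning
    halves-bound (suc zero) {g₀} s<n h close =
      first-half-only 1 g₀ (length-configuration-zero 1 n) (bounded 1 s<n (Halves.within h))
        λ { v p → case close v v p p of λ { (s≤s ()) } }
    halves-bound zero {g₀} s<n h close =
      first-half-only 0 g₀ (length-configuration-zero 0 n) (bounded 0 s<n (Halves.within h))
        λ { v p → case close v v p p of λ () }

    kleitman-step : ∀ s {f : Family (suc (suc n))} → s < suc (suc n) → Diameter≤ s f →
                    card f ≤ length (B s (suc (suc n)))
    kleitman-step s {f} (s≤s s≤n) diam with m≤n⇒m<n∨m≡n s≤n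
    -- The induction hypothesis demands a diameter below the dimension of the sections, so the
    -- largest value of `s` is settled by antipodes.
    ... | inj₂ refl = ≤-trans (antipodal-bound diam) (half-configuration (suc n))
    ... | inj₁ s<n with compress (allFin (suc n)) (push-down diam)
    ... | g₀ , g₁ , h , eq , closed = begin
      card f                             ≡⟨ sym (card-∪∩ f₀ f₁) ⟩
      card (f₀ ∪ᶠ f₁) + card (f₀ ∩ᶠ f₁)  ≡⟨ sym eq ⟩
      card g₀ + card g₁                  ≤⟨ halves-bound s s<n h
                                              (second-half s≤n h (λ x → closed (∈-allFin x))) ⟩
      length (B s (suc (suc n)))         ∎
      where
      open ≤-Reasoning
      f₀ = f ∘ (false ∷_)
      f₁ = f ∘ (true ∷_)

  kleitman : ∀ n s {f : Family n} → s < n → Diameter≤ s f → card f ≤ length (B s n)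
  kleitman (suc zero)    zero _ diam = ≤-trans (antipodal-bound diam) (half-configuration 0)
  kleitman (suc zero)    (suc s) (s≤s ()) diam
  kleitman (suc (suc n)) s s<n diam = kleitman-step n (kleitman (suc n)) s s<n diam

-- Words with jokers, their clashes and their subcubes.

module Words where
  open Hypercube
  open import Data.Bool as Bool using (Bool; true; false; not; _∧_; _xor_; if_then_else_)
  open import Data.Fin as Fin using (Fin; zero; suc)
  open import Data.Fin.Properties as Fin using ()
  open import Data.List using (length)
  open import Data.Maybe using (Maybe; just; nothing)
  open import Data.Nat
  open import Data.Nat.Combinatorics using (_C_; k>n⇒nCk≡0; nCk+nC[k+1]≡[n+1]C[k+1])
  open import Data.Nat.Properties
  open import Data.Nat.Tactic.RingSolver using (solve-∀)
  open import Data.Product using (∃; _,_; proj₁; proj₂)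
  open import Data.Sum using (inj₁; inj₂)
  open import Data.Vec as Vec using (Vec; []; _∷_; sum; tabulate; zipWith)
  open import Data.Vec.Properties using (tabulate-cong; ∷-injectiveˡ; ∷-injectiveʳ)
  open import Function using (_∘_)
  open import Relation.Binary.PropositionalEquality
  open import Relation.Nullary using (¬_; yes; no)

  total : ∀ {N} → (Fin N → ℕ) → ℕ
  total f = sum (tabulate f)

  total-cong : ∀ {N} {f g : Fin N → ℕ} → (∀ i → f i ≡ g i) → total f ≡ total g
  total-cong eq = cong sum (tabulate-cong eq)

  total-mono : ∀ {N} {f g : Fin N → ℕ} → (∀ i → f i ≤ g i) → total f ≤ total g
  total-mono {zero}  f≤g = z≤n
  total-mono {suc N} f≤g = +-mono-≤ (f≤g zero) (total-mono (f≤g ∘ suc))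

  total-const : ∀ N c → total {N} (λ _ → c) ≡ N * c
  total-const zero    c = refl
  total-const (suc N) c = cong (c +_) (total-const N c)

  total-+ : ∀ {N} (f g : Fin N → ℕ) → total (λ i → f i + g i) ≡ total f + total g
  total-+ {zero}  f g = refl
  total-+ {suc N} f g =
    trans (cong (f zero + g zero +_) (total-+ (f ∘ suc) (g ∘ suc)))
          (interchange (f zero) (g zero) (total (f ∘ suc)) (total (g ∘ suc)))

  total-* : ∀ {N} c (f : Fin N → ℕ) → total (λ i → c * f i) ≡ c * total f
  total-* {zero}  c f = sym (*-zeroʳ c)
  total-* {suc N} c f =
    trans (cong (c * f zero +_) (total-* c (f ∘ suc))) (sym (*-distribˡ-+ c (f zero) _))

  ⋃ : ∀ {N n} → (Fin N → Family n) → Family n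
  ⋃ {zero}  f v = false
  ⋃ {suc N} f   = f zero ∪ᶠ ⋃ (f ∘ suc)

  ∈-⋃⁻ : ∀ {N n} (f : Fin N → Family n) {v} → v ∈ᶠ ⋃ f → ∃ λ i → v ∈ᶠ f i
  ∈-⋃⁻ {suc N} f v∈ with ∨-true v∈
  ... | inj₁ v∈f₀ = zero , v∈f₀
  ... | inj₂ v∈⋃ with ∈-⋃⁻ (f ∘ suc) v∈⋃
  ... | i , v∈fᵢ = suc i , v∈fᵢ

  Disjoint : ∀ {N n} → (Fin N → Family n) → Set
  Disjoint f = ∀ i j → i ≢ j → ∀ v → v ∈ᶠ f i → ¬ v ∈ᶠ f j

  card-⋃ : ∀ {N n} (f : Fin N → Family n) → Disjoint f → card (⋃ f) ≡ total (card ∘ f)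
  card-⋃ {zero}  {n} f disj = card-empty {n} {λ _ → false} λ _ ()
  card-⋃ {suc N} {n} f disj = begin
    card (f zero ∪ᶠ ⋃ (f ∘ suc))       ≡⟨ card-⊎ (f zero) (⋃ (f ∘ suc)) apart ⟩
    card (f zero) + card (⋃ (f ∘ suc)) ≡⟨ cong (card (f zero) +_) (card-⋃ (f ∘ suc)
                                            λ i j i≢j → disj (suc i) (suc j) (i≢j ∘ Fin.suc-injective)) ⟩
    total (card ∘ f)                   ∎
    where
    open ≡-Reasoning
    apart : ∀ v → v ∈ᶠ f zero → ¬ v ∈ᶠ ⋃ (f ∘ suc)
    apart v p q with ∈-⋃⁻ (f ∘ suc) q
    ... | i , r = disj zero (suc i) (λ ()) v p r

  -- nothing is the joker symbol ∗, so that a word stands for a subcube.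
  Word : ℕ → Set
  Word n = Vec (Maybe Bool) n

  clash : Maybe Bool → Maybe Bool → Bool
  clash (just a) (just b) = a xor b
  clash (just _) nothing  = false
  clash nothing  _        = false

  clashes : ∀ {n} → Word n → Word n → ℕ
  clashes []      []        = 0
  clashes (a ∷ w) (a′ ∷ w′) = ⟦ clash a a′ ⟧ᵇ + clashes w w′

  clashes-self : ∀ {n} (w : Word n) → clashes w w ≡ 0
  clashes-self []               = refl
  clashes-self (nothing ∷ w)    = clashes-self w
  clashes-self (just true ∷ w)  = clashes-self w
  clashes-self (just false ∷ w) = clashes-self w

  stars : ∀ {n} → Word n → ℕ
  stars []            = 0
  stars (nothing ∷ w) = suc (stars w)
  stars (just _ ∷ w)  = stars w

  subcube : ∀ {n} → Word n → Family n
  subcube []            []      = true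
  subcube (nothing ∷ w) (b ∷ v) = subcube w v
  subcube (just a ∷ w)  (b ∷ v) = not (a xor b) ∧ subcube w v

  card-subcube : ∀ {n} (w : Word n) → card (subcube w) ≡ 2 ^ stars w
  card-subcube []                   = refl
  card-subcube (nothing ∷ w)        =
    trans (cong₂ _+_ (card-subcube w) (card-subcube w)) (cong (2 ^ stars w +_) (sym (+-identityʳ _)))
  card-subcube {suc n} (just true ∷ w)  =
    trans (cong (_+ card (subcube w)) (card-empty {n} {λ _ → false} λ _ ())) (card-subcube w)
  card-subcube {suc n} (just false ∷ w) =
    trans (cong (card (subcube w) +_) (card-empty {n} {λ _ → false} λ _ ()))
          (trans (+-identityʳ _) (card-subcube w))

  clash≤xor : ∀ {n} a a′ b b′ (w w′ : Word n) {v v′} →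
              (b ∷ v) ∈ᶠ subcube (a ∷ w) → (b′ ∷ v′) ∈ᶠ subcube (a′ ∷ w′) →
              ⟦ clash a a′ ⟧ᵇ ≤ ⟦ b xor b′ ⟧ᵇ
  clash≤xor nothing      _            _     _     _ _ _ _ = z≤n
  clash≤xor (just _)     nothing      _     _     _ _ _ _ = z≤n
  clash≤xor (just true)  (just true)  _     _     _ _ _ _ = z≤n
  clash≤xor (just false) (just false) _     _     _ _ _ _ = z≤n
  clash≤xor (just true)  (just false) true  false _ _ _ _ = ≤-refl
  clash≤xor (just false) (just true)  false true  _ _ _ _ = ≤-refl

  subcube-tail : ∀ {n} a b (w : Word n) {v} → (b ∷ v) ∈ᶠ subcube (a ∷ w) → v ∈ᶠ subcube w
  subcube-tail nothing  b w p = p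
  subcube-tail (just a) b w p = proj₂ (∧-true {not (a xor b)} p)

  -- At a clash both words fix the coordinate, to opposite values, so any two members differ there.
  -- Applied to a common member, this makes the subcubes of clashing words disjoint.
  clashes≤dist : ∀ {n} (w w′ : Word n) {v v′} → v ∈ᶠ subcube w → v′ ∈ᶠ subcube w′ →
                 clashes w w′ ≤ dist v v′
  clashes≤dist []      []        {[]}    {[]}      p q = z≤n
  clashes≤dist (a ∷ w) (a′ ∷ w′) {b ∷ v} {b′ ∷ v′} p q =
    +-mono-≤ (clash≤xor a a′ b b′ w w′ p q)
             (clashes≤dist w w′ (subcube-tail a b w p) (subcube-tail a′ b′ w′ q))

  dist-self : ∀ {n} (v : Cube n) → dist v v ≡ 0
  dist-self []          = refl
  dist-self (true ∷ v)  = dist-self v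
  dist-self (false ∷ v) = dist-self v

  clash⇒disjoint : ∀ {n} {w w′ : Word n} → 1 ≤ clashes w w′ →
                   ∀ v → v ∈ᶠ subcube w → ¬ v ∈ᶠ subcube w′
  clash⇒disjoint {w = w} {w′} 1≤c v p q =
    1+n≰n (≤-trans 1≤c (subst (clashes w w′ ≤_) (dist-self v) (clashes≤dist w w′ p q)))

  ⟦⟧ᵇ≤1 : ∀ b → ⟦ b ⟧ᵇ ≤ 1
  ⟦⟧ᵇ≤1 true  = ≤-refl
  ⟦⟧ᵇ≤1 false = z≤n

  -- Two members differ in a coordinate only if the letters clash or one of them is a joker. With at
  -- most `k` clashes this controls distances between the layers below.
  dist≤clashes+stars : ∀ {n} (w w′ : Word n) {v v′} → v ∈ᶠ subcube w → v′ ∈ᶠ subcube w′ →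
                       dist v v′ ≤ clashes w w′ + (stars w + stars w′)
  dist≤clashes+stars []      []        {[]}    {[]}      p q = z≤n
  dist≤clashes+stars (nothing ∷ w) (a′ ∷ w′) {b ∷ v} {b′ ∷ v′} p q = begin
    ⟦ b xor b′ ⟧ᵇ + dist v v′
      ≤⟨ +-mono-≤ (⟦⟧ᵇ≤1 (b xor b′)) (dist≤clashes+stars w w′ p (subcube-tail a′ b′ w′ q)) ⟩
    suc (clashes w w′ + (stars w + stars w′))
      ≡⟨ sym (+-suc (clashes w w′) _) ⟩
    clashes w w′ + (suc (stars w) + stars w′)
      ≤⟨ +-monoʳ-≤ (clashes w w′) (+-monoʳ-≤ (suc (stars w)) (stars-tail a′)) ⟩
    clashes w w′ + (suc (stars w) + stars (a′ ∷ w′)) ∎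
    where
    open ≤-Reasoning
    stars-tail : ∀ a → stars w′ ≤ stars (a ∷ w′)
    stars-tail nothing  = n≤1+n _
    stars-tail (just _) = ≤-refl
  dist≤clashes+stars (just a ∷ w) (nothing ∷ w′) {b ∷ v} {b′ ∷ v′} p q = begin
    ⟦ b xor b′ ⟧ᵇ + dist v v′
      ≤⟨ +-mono-≤ (⟦⟧ᵇ≤1 (b xor b′)) (dist≤clashes+stars w w′ (subcube-tail (just a) b w p) q) ⟩
    suc (clashes w w′ + (stars w + stars w′))
      ≡⟨ sym (trans (cong (clashes w w′ +_) (+-suc (stars w) _)) (+-suc (clashes w w′) _)) ⟩
    clashes w w′ + (stars w + suc (stars w′)) ∎
    where open ≤-Reasoning
  dist≤clashes+stars (just a ∷ w) (just a′ ∷ w′) {b ∷ v} {b′ ∷ v′} p q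
    with ih ← dist≤clashes+stars w w′ (subcube-tail (just a) b w p) (subcube-tail (just a′) b′ w′ q) =
    ≤-trans (+-mono-≤ (xor≤clash a a′ b b′ p q) ih) (≤-reflexive (sym (+-assoc ⟦ a xor a′ ⟧ᵇ _ _)))
    where
    xor≤clash : ∀ a a′ b b′ → not (a xor b) ∧ subcube w v ≡ true → not (a′ xor b′) ∧ subcube w′ v′ ≡ true →
                ⟦ b xor b′ ⟧ᵇ ≤ ⟦ a xor a′ ⟧ᵇ
    xor≤clash true  true  true  true  _ _ = ≤-refl
    xor≤clash true  false true  false _ _ = ≤-refl
    xor≤clash false true  false true  _ _ = ≤-refl
    xor≤clash false false false false _ _ = ≤-refl

  -- Clash patterns against a fixed word.

  marks : ∀ {n} → Word n → Word n → Cube n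
  marks = zipWith clash

  ones-marks : ∀ {n} (u w : Word n) → ones (marks u w) ≡ clashes u w
  ones-marks []      []      = refl
  ones-marks (a ∷ u) (b ∷ w) with clash a b
  ... | true  = cong suc (ones-marks u w)
  ... | false = ones-marks u w

  -- Where `w` and `w′` clash they carry opposite values, and the letter of `u`, not being a joker,
  -- clashes with exactly one of them. Equal marks therefore rule out any clash.
  marks-injective : ∀ {n} (u w w′ : Word n) → stars u ≡ 0 → marks u w ≡ marks u w′ → clashes w w′ ≡ 0
  marks-injective []           []      []        _ _  = refl
  marks-injective (just a ∷ u) (b ∷ w) (b′ ∷ w′) s eq =
    cong₂ _+_ (cong ⟦_⟧ᵇ (no-clash a b b′ (∷-injectiveˡ eq))) (marks-injective u w w′ s (∷-injectiveʳ eq))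
    where
    no-clash : ∀ a b b′ → clash (just a) b ≡ clash (just a) b′ → clash b b′ ≡ false
    no-clash _     nothing      _            _  = refl
    no-clash _     (just _)     nothing      _  = refl
    no-clash _     (just true)  (just true)  _  = refl
    no-clash _     (just false) (just false) _  = refl
    no-clash true  (just true)  (just false) ()
    no-clash true  (just false) (just true)  ()
    no-clash false (just true)  (just false) ()
    no-clash false (just false) (just true)  ()

  -- A point as a subcube without jokers, so that singletons inherit the lemmas on cardinality and
  -- disjoint unions.
  vertex : ∀ {n} → Cube n → Word n
  vertex = Vec.map just

  stars-vertex : ∀ {n} (v : Cube n) → stars (vertex v) ≡ 0
  stars-vertex []      = refl
  stars-vertex (_ ∷ v) = stars-vertex v

  ∈-vertex : ∀ {n} (u : Cube n) {v} → v ∈ᶠ subcube (vertex u) → v ≡ u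
  ∈-vertex []          {[]}        _ = refl
  ∈-vertex (true ∷ u)  {true ∷ v}  p = cong (true ∷_) (∈-vertex u p)
  ∈-vertex (false ∷ u) {false ∷ v} p = cong (false ∷_) (∈-vertex u p)

  ≤ᵇ-true⁻ : ∀ m n → (m ≤ᵇ n) ≡ true → m ≤ n
  ≤ᵇ-true⁻ m n p = ≤ᵇ⇒≤ m n (subst Bool.T (sym p) _)

  -- Volumes layered by the number of jokers.

  weight : ∀ {n} → ℕ → Word n → ℕ
  weight j w = if stars w ≤ᵇ j then 2 ^ stars w else 0

  -- Words with too many jokers contribute the empty family instead of being removed, so every layer
  -- is indexed by the same `Fin N`.
  truncated : ∀ {n} → ℕ → Word n → Family n
  truncated j w v = (stars w ≤ᵇ j) ∧ subcube w v

  card-truncated : ∀ {n} j (w : Word n) → card (truncated j w) ≡ weight j w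
  card-truncated {n} j w with stars w ≤ᵇ j
  ... | true  = card-subcube w
  ... | false = card-empty {n} {λ _ → false} λ _ ()

  -- 2ᴶ ∑ⱼ₌₁ᴶ S(j)/2ʲ
  horner : ℕ → (ℕ → ℕ) → ℕ
  horner zero    S = 0
  horner (suc J) S = 2 * horner J S + S (suc J)

  horner-total : ∀ {N} J (S : Fin N → ℕ → ℕ) →
                 total (λ i → horner J (S i)) ≡ horner J (λ j → total (λ i → S i j))
  horner-total {N} zero S = trans (total-const N 0) (*-zeroʳ N)
  horner-total (suc J) S = begin
    total (λ i → 2 * horner J (S i) + S i (suc J))
      ≡⟨ total-+ (λ i → 2 * horner J (S i)) (λ i → S i (suc J)) ⟩
    total (λ i → 2 * horner J (S i)) + total (λ i → S i (suc J))
      ≡⟨ cong (_+ total (λ i → S i (suc J))) (trans (total-* 2 (λ i → horner J (S i)))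
           (cong (2 *_) (horner-total J S))) ⟩
    _ ∎
    where open ≡-Reasoning

  -- A geometric sum: for `s ≤ J` jokers, `horner` is `2 ^ J` times the sum of `2 ^ s / 2 ^ j` over
  -- `s ≤ j ≤ J`, which is `2 ^ (J + 1) - 2 ^ s`. For `s > J` the term `2 ^ stars w` suffices alone.
  -- The sum begins at `j = 1`, whence the assumption on `stars w`.
  horner-weight : ∀ {n} (w : Word n) → 1 ≤ stars w → ∀ J →
                  2 ^ suc J ≤ horner J (λ j → weight j w) + 2 ^ stars w
  horner-weight w 1≤s zero = ^-monoʳ-≤ 2 1≤s
  horner-weight w 1≤s (suc J) with stars w ≤? suc J
  ... | no  s≰J = ≤-trans (^-monoʳ-≤ 2 (≰⇒> s≰J)) (m≤n+m _ _)
  ... | yes s≤J = begin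
    2 * 2 ^ suc J                                            ≤⟨ *-monoʳ-≤ 2 (horner-weight w 1≤s J) ⟩
    2 * (horner J (λ j → weight j w) + 2 ^ stars w)
      -- One copy of `2 ^ stars w` becomes the new summand of `horner`, the other stays as the
      -- remainder.
      ≡⟨ double (horner J (λ j → weight j w)) (2 ^ stars w) ⟩
    2 * horner J (λ j → weight j w) + 2 ^ stars w + 2 ^ stars w
      ≡⟨ cong (λ b → 2 * horner J (λ j → weight j w) + (if b then 2 ^ stars w else 0) + 2 ^ stars w)
           (sym (≤ᵇ-true s≤J)) ⟩
    horner (suc J) (λ j → weight j w) + 2 ^ stars w          ∎
    where
    open ≤-Reasoning
    double : ∀ a b → 2 * (a + b) ≡ 2 * a + b + b
    double = solve-∀

  record NeighborlyWords (k : ℕ) {N d : ℕ} (w : Fin N → Word d) : Set where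
    field
      clash≥1 : ∀ i j → i ≢ j → 1 ≤ clashes (w i) (w j)
      clash≤k : ∀ i j → i ≢ j → clashes (w i) (w j) ≤ k

  module _ {k N d} {w : Fin N → Word d} (nw : NeighborlyWords k w) where
    open NeighborlyWords nw

    clashes≤k : ∀ i j → clashes (w i) (w j) ≤ k
    clashes≤k i j with i Fin.≟ j
    ... | yes refl = subst (_≤ k) (sym (clashes-self (w i))) z≤n
    ... | no  i≢j  = clash≤k i j i≢j

    subcubes-disjoint : Disjoint (subcube ∘ w)
    subcubes-disjoint i j i≢j = clash⇒disjoint {w = w i} {w j} (clash≥1 i j i≢j)

    truncated-disjoint : ∀ j → Disjoint (truncated j ∘ w)
    truncated-disjoint j i i′ i≢i′ v p q =
      subcubes-disjoint i i′ i≢i′ v (proj₂ (∧-true {stars (w i) ≤ᵇ j} p))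
                                    (proj₂ (∧-true {stars (w i′) ≤ᵇ j} q))

    -- The marks against `w i₀` have at most `k` ones, and they are pairwise distinct because any
    -- two words clash. The index `i₀` itself contributes the zero vector.
    star-free-bound : ∀ i → stars (w i) ≡ 0 → N ≤ card (ball k d)
    star-free-bound i₀ s≡0 = begin
      N                      ≡⟨ sym (trans (total-const N 1) (*-identityʳ N)) ⟩
      total {N} (λ _ → 1)    ≡⟨ total-cong (λ i → sym (trans (card-subcube (vertex (mark i)))
                                  (cong (2 ^_) (stars-vertex (mark i))))) ⟩
      total (card ∘ singleton)   ≡⟨ sym (card-⋃ singleton singletons-disjoint) ⟩
      card (⋃ singleton)         ≤⟨ card-mono {f = ⋃ singleton} in-ball ⟩
      card (ball k d)        ∎
      where
      open ≤-Reasoning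
      mark : Fin N → Cube d
      mark i = marks (w i₀) (w i)
      singleton : Fin N → Family d
      singleton i = subcube (vertex (mark i))
      singletons-disjoint : Disjoint singleton
      singletons-disjoint i j i≢j v p q = 1+n≰n (≤-trans (clash≥1 i j i≢j) (≤-reflexive
        (marks-injective (w i₀) (w i) (w j) s≡0 (trans (sym (∈-vertex (mark i) p)) (∈-vertex (mark j) q)))))
      in-ball : ∀ v → v ∈ᶠ ⋃ singleton → v ∈ᶠ ball k d
      in-ball v p with ∈-⋃⁻ singleton p
      ... | i , q rewrite ∈-vertex (mark i) q =
        ≤ᵇ-true (subst (_≤ k) (sym (ones-marks (w i₀) (w i))) (clashes≤k i₀ i))

    -- This is S(j): the subcubes being disjoint, the total weight equals the size of the union, as
    -- `card-layer` shows.
    volume : ℕ → ℕ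
    volume j = total (weight j ∘ w)

    private
      layer : ℕ → Family d
      layer j = ⋃ (truncated j ∘ w)

      card-layer : ∀ j → card (layer j) ≡ volume j
      card-layer j = trans (card-⋃ (truncated j ∘ w) (truncated-disjoint j))
                           (total-cong (λ i → card-truncated j (w i)))

      layer-dist : ∀ j j′ u v → u ∈ᶠ layer j → v ∈ᶠ layer j′ → dist u v ≤ k + (j + j′)
      layer-dist j j′ u v p q with ∈-⋃⁻ (truncated j ∘ w) p | ∈-⋃⁻ (truncated j′ ∘ w) q
      ... | i , p′ | i′ , q′ = ≤-trans
        (dist≤clashes+stars (w i) (w i′) (proj₂ (∧-true {stars (w i) ≤ᵇ j} p′))
                                         (proj₂ (∧-true {stars (w i′) ≤ᵇ j′} q′)))
        (+-mono-≤ (clashes≤k i i′) (+-mono-≤ (≤ᵇ-true⁻ (stars (w i)) j (proj₁ (∧-true p′)))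
                                             (≤ᵇ-true⁻ (stars (w i′)) j′ (proj₁ (∧-true q′)))))

    volume≤B : ∀ j → k + 2 * j < d → volume j ≤ length (B (k + 2 * j) d)
    volume≤B j k+2j<d = subst (_≤ _) (card-layer j) (kleitman d (k + 2 * j) k+2j<d
      λ u v p q → subst (λ m → dist u v ≤ k + m) (cong (j +_) (sym (+-identityʳ j)))
                        (layer-dist j j u v p q))

    -- A common member of the first layer and the antipodal image of the second would give a vector
    -- and its antipode in the two layers, at distance `d`, more than `layer-dist` allows.
    volume+volume : ∀ j j′ → k + (j + j′) < d → volume j + volume j′ ≤ 2 ^ d
    volume+volume j j′ small = begin
      volume j + volume j′                           ≡⟨ sym (cong₂ _+_ (card-layer j) (card-layer j′)) ⟩
      card (layer j) + card (layer j′)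
        ≡⟨ cong (card (layer j) +_) (sym (card-antipode (layer j′))) ⟩
      card (layer j) + card (layer j′ ∘ antipode)
        ≤⟨ disjoint-card (layer j) (layer j′ ∘ antipode) (λ v p q → 1+n≰n (<-≤-trans small
             (subst (_≤ k + (j + j′)) (trans (dist-sym v (antipode v)) (dist-antipode v))
               (layer-dist j j′ v (antipode v) p q)))) ⟩
      2 ^ d ∎
      where open ≤-Reasoning

    -- Sums `horner-weight` over all words. The remainders `2 ^ stars` are the sizes of disjoint
    -- subcubes, hence at most `2 ^ d` together.
    horner-bound : (∀ i → 1 ≤ stars (w i)) → ∀ J → N * 2 ^ suc J ≤ horner J volume + 2 ^ d
    horner-bound 1≤s J = begin
      N * 2 ^ suc J
        ≡⟨ sym (total-const N (2 ^ suc J)) ⟩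
      total {N} (λ _ → 2 ^ suc J)
        ≤⟨ total-mono (λ i → horner-weight (w i) (1≤s i) J) ⟩
      total (λ i → horner J (λ j → weight j (w i)) + 2 ^ stars (w i))
        ≡⟨ total-+ (λ i → horner J (λ j → weight j (w i))) (λ i → 2 ^ stars (w i)) ⟩
      total (λ i → horner J (λ j → weight j (w i))) + total (λ i → 2 ^ stars (w i))
        ≡⟨ cong₂ _+_ (horner-total J (λ i j → weight j (w i)))
             (trans (total-cong (λ i → sym (card-subcube (w i))))
                    (sym (card-⋃ (subcube ∘ w) subcubes-disjoint))) ⟩
      horner J volume + card (⋃ (subcube ∘ w))
        ≤⟨ +-monoʳ-≤ (horner J volume) (card≤2^n (⋃ (subcube ∘ w))) ⟩
      horner J volume + 2 ^ d ∎
      where open ≤-Reasoning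

  -- Balls and binomial coefficients.

  card-ball-0 : ∀ n → card (ball 0 n) ≡ 1
  card-ball-0 zero    = refl
  card-ball-0 (suc n) = trans (card-ball-zero n) (card-ball-0 n)

  card-ball-binomial : ∀ k n → card (ball (suc k) n) ≡ card (ball k n) + n C suc k
  card-ball-binomial k       zero    = cong suc (sym (k>n⇒nCk≡0 {0} {suc k} (s≤s z≤n)))
  card-ball-binomial zero    (suc n) = begin
    card (ball 1 (suc n))                        ≡⟨ card-ball-suc 0 n ⟩
    card (ball 1 n) + card (ball 0 n)            ≡⟨ cong (_+ card (ball 0 n)) (card-ball-binomial 0 n) ⟩
    card (ball 0 n) + n C 1 + card (ball 0 n)    ≡⟨ cong (λ m → m + n C 1 + m) (card-ball-0 n) ⟩
    1 + n C 1 + 1                                ≡⟨ +-comm (1 + n C 1) 1 ⟩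
    1 + (n C 0 + n C 1)
      ≡⟨ cong₂ _+_ (sym (card-ball-0 (suc n))) (nCk+nC[k+1]≡[n+1]C[k+1] n 0) ⟩
    card (ball 0 (suc n)) + suc n C 1            ∎
    where open ≡-Reasoning
  card-ball-binomial (suc k) (suc n) = begin
    card (ball (suc (suc k)) (suc n))
      ≡⟨ card-ball-suc (suc k) n ⟩
    card (ball (suc (suc k)) n) + card (ball (suc k) n)
      ≡⟨ cong₂ _+_ (card-ball-binomial (suc k) n) (card-ball-binomial k n) ⟩
    (card (ball (suc k) n) + n C suc (suc k)) + (card (ball k n) + n C suc k)
      ≡⟨ rearrange (card (ball (suc k) n)) (n C suc (suc k)) (card (ball k n)) (n C suc k) ⟩
    (card (ball (suc k) n) + card (ball k n)) + (n C suc k + n C suc (suc k))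
      ≡⟨ cong₂ _+_ (sym (card-ball-suc k n)) (nCk+nC[k+1]≡[n+1]C[k+1] n (suc k)) ⟩
    card (ball (suc k) (suc n)) + suc n C suc (suc k) ∎
    where
    open ≡-Reasoning
    rearrange : ∀ a b c e → (a + b) + (c + e) ≡ (a + c) + (e + b)
    rearrange = solve-∀

-- The order of the reals.

module Boxes where
  open Hypercube using (⟦_⟧ᵇ)
  open Words using (clash; clashes; NeighborlyWords)
  open import Data.Bool using (Bool; true; false)
  open import Data.Empty using (⊥; ⊥-elim)
  open import Data.Fin as Fin using (Fin; zero; suc)
  open import Data.Fin.Properties using (any?; sequence)
  open import Data.Maybe using (Maybe; just; nothing)
  open import Data.Nat
  open import Data.Nat.Properties
  open import Data.Product using (Σ; ∃; _×_; _,_; proj₁; proj₂)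
  open import Data.Sum using (_⊎_; inj₁; inj₂)
  open import Data.Vec using (Vec; sum; tabulate)
  open import Data.Vec.Functional using (updateAt)
  open import Data.Vec.Functional.Properties using (updateAt-updates; updateAt-minimal)
  import Data.Rational.Properties as ℚ
  open import Effect.Monad using (RawMonad)
  open import Function using (_∘_; const)
  open import Relation.Binary.Definitions using (tri<; tri≈; tri>)
  open import Relation.Binary.PropositionalEquality
  open import Relation.Nullary using (¬_; Dec; yes; no)
  open import Relation.Nullary.Decidable using (¬¬-excluded-middle)
  open import Relation.Nullary.Negation using (DoubleNegation; ¬¬-Monad)
  open import Relation.Unary using (_∩_; _≐_)

  ≤ᴿ-refl : ∀ {x} → x ≤ᴿ x
  ≤ᴿ-refl q Lq = Lq

  ≤ᴿ-trans : ∀ {x y z} → x ≤ᴿ y → y ≤ᴿ z → x ≤ᴿ z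
  ≤ᴿ-trans x≤y y≤z q Lq = y≤z q (x≤y q Lq)

  <ᴿ⇒≱ᴿ : ∀ {x y} → x <ᴿ y → ¬ y ≤ᴿ x
  <ᴿ⇒≱ᴿ {x} (q , Uq , Lq) y≤x = ℝ.disjoint x (y≤x q Lq , Uq)

  <ᴿ⇒≤ᴿ : ∀ {x y} → x <ᴿ y → x ≤ᴿ y
  <ᴿ⇒≤ᴿ {x} {y} (r , Ur , Lr) s Ls with ℚ.<-cmp s r
  ... | tri< s<r _ _  = ℝ.L-closed y s<r Lr
  ... | tri≈ _ refl _ = Lr
  ... | tri> _ _ r<s  = ⊥-elim (ℝ.disjoint x (ℝ.L-closed x r<s Ls , Ur))

  -- Locatedness takes the place of excluded middle: for `q < r` in the lower cut of `y`, either `q`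
  -- is in the lower cut of `x`, or `r` separates `x` from `y` and the assumption is contradicted.
  ≰ᴿ⇒≥ᴿ : ∀ {x y} → ¬ x ≤ᴿ y → y ≤ᴿ x
  ≰ᴿ⇒≥ᴿ {x} {y} x≰y q Lq with ℝ.L-open y Lq
  ... | r , q<r , Lr with ℝ.located x q<r
  ... | inj₁ Lx = Lx
  ... | inj₂ Ux = ⊥-elim (x≰y (<ᴿ⇒≤ᴿ {x} {y} (r , Ux , Lr)))

  -- The order is defined by lower cuts; openness and locatedness carry it over to upper cuts.
  ≤ᴿ-U : ∀ {x y} → x ≤ᴿ y → ∀ {q} → ℝ.U y q → ℝ.U x q
  ≤ᴿ-U {x} {y} x≤y Uq with ℝ.U-open y Uq
  ... | r , r<q , Ur with ℝ.located x r<q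
  ... | inj₁ Lx = ⊥-elim (ℝ.disjoint y (x≤y r Lx , Ur))
  ... | inj₂ Ux = Ux

  ≤ᴿ-total : ∀ {x y} → Dec (x ≤ᴿ y) → x ≤ᴿ y ⊎ y ≤ᴿ x
  ≤ᴿ-total (yes x≤y) = inj₁ x≤y
  ≤ᴿ-total {x} {y} (no  x≰y) = inj₂ (≰ᴿ⇒≥ᴿ {x} {y} x≰y)

  -- Intersections of intervals and of boxes.

  infix 4 _∈ᴵ_ _∈ᴮ_

  _∈ᴵ_ : ℝ → Interval → Set
  y ∈ᴵ I = lo I ≤ᴿ y × y ≤ᴿ hi I

  lo∈ : ∀ I → lo I ∈ᴵ I
  lo∈ I = ≤ᴿ-refl {lo I} , lo≤hi I

  hi∈ : ∀ I → hi I ∈ᴵ I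
  hi∈ I = lo≤hi I , ≤ᴿ-refl {hi I}

  module _ {I J M : Interval} (I∩J⊆M : ∀ y → y ∈ᴵ I → y ∈ᴵ J → y ∈ᴵ M)
           (M⊆I : ∀ y → y ∈ᴵ M → y ∈ᴵ I) (M⊆J : ∀ y → y ∈ᴵ M → y ∈ᴵ J) where

    touching⇒degenerate : hi I ≤ᴿ lo J → hi M ≤ᴿ lo M
    touching⇒degenerate hI≤lJ =
      ≤ᴿ-trans {hi M} {hi I} {lo M} (proj₂ (M⊆I (hi M) (hi∈ M)))
        (≤ᴿ-trans {hi I} {lo J} {lo M} hI≤lJ (proj₁ (M⊆J (lo M) (lo∈ M))))

    -- The intersection runs from the larger lower end to the smaller upper end. If one interval
    -- lies inside the other, its own ends would coincide; otherwise the coinciding ends are those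
    -- where the two intervals touch. Comparing ends needs excluded middle, hence the double
    -- negation.
    degenerate⇒touching : lo I <ᴿ hi I → lo J <ᴿ hi J → hi M ≤ᴿ lo M →
                          ¬ hi I ≤ᴿ lo J → ¬ ¬ hi J ≤ᴿ lo I
    degenerate⇒touching I° J° hM≤lM hI≰lJ hJ≰lI =
      ¬¬-excluded-middle λ lo? → ¬¬-excluded-middle λ hi? →
        clash-ends (≤ᴿ-total {lo I} {lo J} lo?) (≤ᴿ-total {hi I} {hi J} hi?)
      where
      lI≤hJ : lo I ≤ᴿ hi J
      lI≤hJ = ≤ᴿ-trans {lo I} {lo M} {hi J} (proj₁ (M⊆I (lo M) (lo∈ M))) (proj₂ (M⊆J (lo M) (lo∈ M)))
      lJ≤hI : lo J ≤ᴿ hi I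
      lJ≤hI = ≤ᴿ-trans {lo J} {lo M} {hi I} (proj₁ (M⊆J (lo M) (lo∈ M))) (proj₂ (M⊆I (lo M) (lo∈ M)))
      collapse : ∀ {x y} → x ∈ᴵ I → x ∈ᴵ J → y ∈ᴵ I → y ∈ᴵ J → y ≤ᴿ x
      collapse {x} {y} xI xJ yI yJ =
        ≤ᴿ-trans {y} {hi M} {x} (proj₂ (I∩J⊆M y yI yJ))
          (≤ᴿ-trans {hi M} {lo M} {x} hM≤lM (proj₁ (I∩J⊆M x xI xJ)))
      clash-ends : lo I ≤ᴿ lo J ⊎ lo J ≤ᴿ lo I → hi I ≤ᴿ hi J ⊎ hi J ≤ᴿ hi I → ⊥
      clash-ends (inj₁ l) (inj₁ h) =
        hI≰lJ (collapse {lo J} {hi I} (l , lJ≤hI) (lo∈ J) (hi∈ I) (lJ≤hI , h))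
      clash-ends (inj₁ l) (inj₂ h) =
        <ᴿ⇒≱ᴿ {lo J} {hi J} J° (collapse {lo J} {hi J} (l , lJ≤hI) (lo∈ J) (lI≤hJ , h) (hi∈ J))
      clash-ends (inj₂ l) (inj₁ h) =
        <ᴿ⇒≱ᴿ {lo I} {hi I} I° (collapse {lo I} {hi I} (lo∈ I) (l , lI≤hJ) (hi∈ I) (lJ≤hI , h))
      clash-ends (inj₂ l) (inj₂ h) =
        hJ≰lI (collapse {lo I} {hi J} (lo∈ I) (l , lI≤hJ) (lI≤hJ , h) (hi∈ J))

  _∈ᴮ_ : ∀ {d} → Point d → Box d → Set
  x ∈ᴮ K = ⟦ K ⟧ x

  update-∈ : ∀ {d} (K : Box d) (x : Point d) c y → x ∈ᴮ K → y ∈ᴵ K c → updateAt x c (const y) ∈ᴮ K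
  update-∈ K x c y x∈K y∈Kc i with i Fin.≟ c
  ... | yes refl = subst (_∈ᴵ K c) (sym (updateAt-updates c x)) y∈Kc
  ... | no  i≢c  = subst (_∈ᴵ K i) (sym (updateAt-minimal i c x i≢c)) (x∈K i)

  update-∈⁻ : ∀ {d} (K : Box d) (x : Point d) c y → updateAt x c (const y) ∈ᴮ K → y ∈ᴵ K c
  update-∈⁻ K x c y ∈K = subst (_∈ᴵ K c) (updateAt-updates c x) (∈K c)

  module _ {d} {K K′ M : Box d} (eq : ⟦ K ⟧ ∩ ⟦ K′ ⟧ ≐ ⟦ M ⟧) where
    private
      corner∈M : (lo ∘ M) ∈ᴮ M
      corner∈M = lo∈ ∘ M
      corner∈K : (lo ∘ M) ∈ᴮ K × (lo ∘ M) ∈ᴮ K′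
      corner∈K = proj₂ eq {lo ∘ M} corner∈M

    -- Equality of boxes as sets becomes equality of intervals in each coordinate: the lower corner
    -- of `M` lies in both boxes, and only its coordinate `c` is varied.
    slice-⊇ : ∀ c y → y ∈ᴵ K c → y ∈ᴵ K′ c → y ∈ᴵ M c
    slice-⊇ c y yK yK′ = update-∈⁻ M (lo ∘ M) c y (proj₁ eq {updateAt (lo ∘ M) c (const y)}
      (update-∈ K (lo ∘ M) c y (proj₁ corner∈K) yK , update-∈ K′ (lo ∘ M) c y (proj₂ corner∈K) yK′))

    slice-⊆ : ∀ c y → y ∈ᴵ M c → y ∈ᴵ K c × y ∈ᴵ K′ c
    slice-⊆ c y yM = update-∈⁻ K (lo ∘ M) c y (proj₁ both) , update-∈⁻ K′ (lo ∘ M) c y (proj₂ both)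
      where both = proj₂ eq {updateAt (lo ∘ M) c (const y)} (update-∈ M (lo ∘ M) c y corner∈M yM)

  IntervalDim≤1 : ∀ {I n} → IntervalDim I n → n ≤ 1
  IntervalDim≤1 (point _)         = z≤n
  IntervalDim≤1 (nondegenerate _) = ≤-refl

  sum≤ : ∀ {d} (e : Fin d → ℕ) → (∀ c → e c ≤ 1) → sum (tabulate e) ≤ d
  sum≤ {zero}  e e≤1 = z≤n
  sum≤ {suc d} e e≤1 = +-mono-≤ (e≤1 zero) (sum≤ (e ∘ suc) (e≤1 ∘ suc))

  sum-full : ∀ {d} (e : Fin d → ℕ) → (∀ c → e c ≤ 1) → sum (tabulate e) ≡ d → ∀ c → e c ≡ 1
  sum-full {suc d} e e≤1 full zero with e zero | e≤1 zero
  ... | zero  | _       = ⊥-elim (1+n≰n (subst (_≤ d) full (sum≤ (e ∘ suc) (e≤1 ∘ suc))))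
  ... | suc _ | s≤s z≤n = refl
  sum-full {suc d} e e≤1 full (suc c) = sum-full (e ∘ suc) (e≤1 ∘ suc) tail-full c
    where
    tail-full : sum (tabulate (e ∘ suc)) ≡ d
    tail-full with e zero | e≤1 zero
    ... | zero  | _       = ⊥-elim (1+n≰n (subst (_≤ d) full (sum≤ (e ∘ suc) (e≤1 ∘ suc))))
    ... | suc _ | s≤s z≤n = suc-injective full

  -- `Dim` supplies a box `M` with the same points, whose side dimensions are at most 1 and sum to
  -- `d`, so all are 1. The lower and upper corners of `M` lie in `K`, which carries the strict
  -- inequality over.
  full-dimensional⇒nondegenerate : ∀ {d} (K : Box d) → Dim ⟦ K ⟧ d → ∀ c → lo (K c) <ᴿ hi (K c)
  full-dimensional⇒nondegenerate K (M , (K⊆M , M⊆K) , e , dims , full) c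
    with e c | dims c | sum-full e (IntervalDim≤1 ∘ dims) full c
  ... | 1 | nondegenerate (q , Uq , Lq) | refl =
    q , ≤ᴿ-U {lo (K c)} {lo (M c)} (proj₁ (M⊆K {lo ∘ M} (lo∈ ∘ M) c)) Uq , proj₂ (M⊆K {hi ∘ M} (hi∈ ∘ M) c) q Lq

  -- Letters of the intervals in one coordinate.

  module Letters {N} (I : Fin N → Interval) (nondeg : ∀ i → lo (I i) <ᴿ hi (I i))
                 (meet : ∀ i j → lo (I i) ≤ᴿ hi (I j))
                 (touching? : ∀ i j → Dec (hi (I i) ≤ᴿ lo (I j))) where

    data Letter (i : Fin N) : Maybe Bool → Set where
      left  : ∀ j → hi (I i) ≤ᴿ lo (I j) → Letter i (just false)
      right : ∀ j → hi (I j) ≤ᴿ lo (I i) → Letter i (just true)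
      star  : (∀ j → ¬ hi (I i) ≤ᴿ lo (I j)) → (∀ j → ¬ hi (I j) ≤ᴿ lo (I i)) → Letter i nothing

    letter : ∀ i → ∃ (Letter i)
    letter i with any? (touching? i) | any? (λ j → touching? j i)
    ... | yes (j , p) | _           = just false , left j p
    ... | no _        | yes (j , p) = just true , right j p
    ... | no ¬l       | no ¬r       = nothing , star (λ j p → ¬l (j , p)) (λ j p → ¬r (j , p))

    -- The one-dimensional Helly property: as any two intervals meet, all touching happens at the
    -- same point. So an interval on the left touches every interval on the right, whichever
    -- partners certified their letters.
    left-right : ∀ {i j a b} → hi (I i) ≤ᴿ lo (I a) → hi (I b) ≤ᴿ lo (I j) → hi (I i) ≤ᴿ lo (I j)
    left-right {i} {j} {a} {b} p q =
      ≤ᴿ-trans {hi (I i)} {lo (I a)} {lo (I j)} p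
        (≤ᴿ-trans {lo (I a)} {hi (I b)} {lo (I j)} (meet a b) q)

    -- Both together would make the interval degenerate. Hence trying `left` first in `letter` is no
    -- real choice.
    ¬left-right : ∀ {i a b} → hi (I i) ≤ᴿ lo (I a) → ¬ hi (I b) ≤ᴿ lo (I i)
    ¬left-right {i} {a} {b} p q = <ᴿ⇒≱ᴿ {lo (I i)} {hi (I i)} (nondeg i) (left-right {i} {i} {a} {b} p q)

    clash-touching : ∀ {i j x y} → Letter i x → Letter j y →
                     hi (I i) ≤ᴿ lo (I j) ⊎ hi (I j) ≤ᴿ lo (I i) → clash x y ≡ true
    clash-touching                 (left _ _)  (right _ _) _        = refl
    clash-touching                 (right _ _) (left _ _)  _        = refl
    clash-touching {i} {j}         (left a p)  (left b q)  (inj₁ r) = ⊥-elim (¬left-right {j} {b} {i} q r)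
    clash-touching {i} {j}         (left a p)  (left b q)  (inj₂ r) = ⊥-elim (¬left-right {i} {a} {j} p r)
    clash-touching {i} {j}         (right a p) (right b q) (inj₁ r) = ⊥-elim (¬left-right {i} {j} {a} r p)
    clash-touching {i} {j}         (right a p) (right b q) (inj₂ r) = ⊥-elim (¬left-right {j} {i} {b} r q)
    clash-touching {i} {j}         (star p q)  _           (inj₁ r) = ⊥-elim (p j r)
    clash-touching {i} {j}         (star p q)  _           (inj₂ r) = ⊥-elim (q j r)
    clash-touching {i} {j}         (left _ _)  (star p q)  (inj₁ r) = ⊥-elim (q i r)
    clash-touching {i} {j}         (left _ _)  (star p q)  (inj₂ r) = ⊥-elim (p i r)
    clash-touching {i} {j}         (right _ _) (star p q)  (inj₁ r) = ⊥-elim (q i r)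
    clash-touching {i} {j}         (right _ _) (star p q)  (inj₂ r) = ⊥-elim (p i r)

    clash-apart : ∀ {i j x y} → Letter i x → Letter j y →
                  ¬ hi (I i) ≤ᴿ lo (I j) → ¬ hi (I j) ≤ᴿ lo (I i) → clash x y ≡ false
    clash-apart         (left _ _)  (left _ _)  _ _ = refl
    clash-apart         (left _ _)  (star _ _)  _ _ = refl
    clash-apart         (right _ _) (right _ _) _ _ = refl
    clash-apart         (right _ _) (star _ _)  _ _ = refl
    clash-apart         (star _ _)  _           _ _ = refl
    clash-apart {i} {j} (left a p)  (right b q) r _ = ⊥-elim (r (left-right {i} {j} {a} {b} p q))
    clash-apart {i} {j} (right a p) (left b q)  _ r = ⊥-elim (r (left-right {j} {i} {b} {a} q p))

    -- The clash at a coordinate is the codimension contributed by that coordinate.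
    dim+clash : ∀ {M : Interval} {i j x y n} → Letter i x → Letter j y → IntervalDim M n →
                (∀ y → y ∈ᴵ I i → y ∈ᴵ I j → y ∈ᴵ M) → (∀ y → y ∈ᴵ M → y ∈ᴵ I i × y ∈ᴵ I j) →
                n + ⟦ clash x y ⟧ᵇ ≡ 1
    dim+clash {M} {i} {j} li lj (nondegenerate M°) ⊆M M⊆ = cong (suc ∘ ⟦_⟧ᵇ) (clash-apart li lj
      (<ᴿ⇒≱ᴿ {lo M} {hi M} M° ∘ touching⇒degenerate {I i} {I j} {M} ⊆M
                                    (λ y → proj₁ ∘ M⊆ y) (λ y → proj₂ ∘ M⊆ y))
      (<ᴿ⇒≱ᴿ {lo M} {hi M} M° ∘ touching⇒degenerate {I j} {I i} {M} (λ y p q → ⊆M y q p)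
                                    (λ y → proj₂ ∘ M⊆ y) (λ y → proj₁ ∘ M⊆ y)))
    dim+clash {M} {i} {j} li lj (point hM≤lM) ⊆M M⊆ with touching? i j | touching? j i
    ... | yes p | _     = cong ⟦_⟧ᵇ (clash-touching li lj (inj₁ p))
    ... | no _  | yes p = cong ⟦_⟧ᵇ (clash-touching li lj (inj₂ p))
    ... | no ¬p | no ¬q = ⊥-elim (degenerate⇒touching {I i} {I j} {M} ⊆M (λ y → proj₁ ∘ M⊆ y)
      (λ y → proj₂ ∘ M⊆ y) (nondeg i) (nondeg j) hM≤lM ¬p ¬q)

  sum-dim+clashes : ∀ {d} (e : Fin d → ℕ) (a b : Fin d → Maybe Bool) →
                    (∀ c → e c + ⟦ clash (a c) (b c) ⟧ᵇ ≡ 1) →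
                    sum (tabulate e) + clashes (tabulate a) (tabulate b) ≡ d
  sum-dim+clashes {zero}  e a b eq = refl
  sum-dim+clashes {suc d} e a b eq =
    trans (Hypercube.interchange (e zero) (sum (tabulate (e ∘ suc))) ⟦ clash (a zero) (b zero) ⟧ᵇ _)
          (cong₂ _+_ (eq zero) (sum-dim+clashes (e ∘ suc) (a ∘ suc) (b ∘ suc) (eq ∘ suc)))

  -- The bound `d ∸ k ≤ m` with truncated subtraction is read as `d ≤ k + m`, from which `m` is
  -- cancelled.
  codimension-bounds : ∀ {d k m c} → m + c ≡ d → d ∸ k ≤ m → m < d → 1 ≤ c × c ≤ k
  codimension-bounds {d} {k} {m} {c} refl d∸k≤m m<d =
    +-cancelˡ-≤ m 1 c (subst (_≤ m + c) (+-comm 1 m) m<d) ,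
    +-cancelˡ-≤ m c k (≤-trans (m≤n+m∸n (m + c) k)
      (≤-trans (+-monoʳ-≤ k d∸k≤m) (≤-reflexive (+-comm k m))))

  -- The words of a neighborly family.

  module _ {k d N} {F : Fin N → Box d} (neighborly : IsNeighborly k F) where
    open IsNeighborly neighborly

    Touching? : Set
    Touching? = ∀ c i j → Dec (hi (F i c) ≤ᴿ lo (F j c))

    -- Only finitely many comparisons occur, and double negation commutes with finite conjunctions,
    -- so excluded middle may be assumed for all of them at once.
    ¬¬touching? : ¬ ¬ Touching?
    ¬¬touching? = all-fin λ c → all-fin λ i → all-fin λ j → ¬¬-excluded-middle
      where
      all-fin : ∀ {n} {P : Fin n → Set} → (∀ i → DoubleNegation (P i)) → DoubleNegation (∀ i → P i)
      all-fin = sequence (RawMonad.rawApplicative ¬¬-Monad)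

    neighborlyWords : Touching? → Σ (Fin N → Words.Word d) (NeighborlyWords k)
    neighborlyWords touching? = word , record
      { clash≥1 = λ i j i≢j → proj₁ (clash-bounds i j i≢j)
      ; clash≤k = λ i j i≢j → proj₂ (clash-bounds i j i≢j)
      }
      where
      nondeg : ∀ c i → lo (F i c) <ᴿ hi (F i c)
      nondeg c i = full-dimensional⇒nondegenerate (F i) (full-dimensional i) c
      meet : ∀ c i j → lo (F i c) ≤ᴿ hi (F j c)
      meet c i j with i Fin.≟ j
      ... | yes refl = lo≤hi (F i c)
      ... | no  i≢j  with intersections i j i≢j
      -- The lower corner of the intersection lies in both boxes, so the two intervals share a point
      -- in every coordinate.
      ... | _ , (M , (_ , M⊆) , _) , _ with M⊆ {lo ∘ M} (lo∈ ∘ M)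
      ... | p , q = ≤ᴿ-trans {lo (F i c)} {lo (M c)} {hi (F j c)} (proj₁ (p c)) (proj₂ (q c))
      module L c = Letters (λ i → F i c) (nondeg c) (meet c) (touching? c)
      symbol : Fin N → Fin d → Maybe Bool
      symbol i c = proj₁ (L.letter c i)
      word : Fin N → Words.Word d
      word i = tabulate (symbol i)
      clash-bounds : ∀ i j → i ≢ j → 1 ≤ clashes (word i) (word j) × clashes (word i) (word j) ≤ k
      clash-bounds i j i≢j with intersections i j i≢j
      ... | m , (M , eq , e , dims , sum≡m) , d∸k≤m , m<d =
        codimension-bounds (trans (cong (_+ clashes (word i) (word j)) (sym sum≡m)) total-d) d∸k≤m m<d
        where
        total-d = sum-dim+clashes e (symbol i) (symbol j) λ c →
          L.dim+clash c (proj₂ (L.letter c i)) (proj₂ (L.letter c j)) (dims c)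
            (slice-⊇ {K = F i} {F j} {M} eq c) (slice-⊆ {K = F i} {F j} {M} eq c)

open import Data.Integer using (+_)
open import Data.Nat as ℕ using (ℕ)
open import Data.Nat.Combinatorics using (_C_)
open import Data.Nat.Divisibility using (_∣_)
open import Data.Nat.DivMod using (_/_)
open import Data.Product using (_×_)
open import Data.Rational as ℚ using (_+_; _-_; _*_; _⊔_)
open import Relation.Nullary using (¬_)

-- Natural numbers and powers of two among the rationals.

module Rationals where
  open import Data.Integer as ℤ using ()
  import Data.Integer.Properties as ℤ
  open import Data.Nat using (zero; suc)
  import Data.Nat.Properties as ℕ
  open import Data.Rational using (ℚ; 0ℚ; 1ℚ; _≤_; -_; NonNegative; toℚᵘ)
  open import Data.Rational.Properties
  open import Data.Rational.Solver using (module +-*-Solver)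
  open import Data.Rational.Unnormalised as ℚᵘ using (ℚᵘ; mkℚᵘ)
  import Data.Rational.Unnormalised.Properties as ℚᵘ
  open import Function using (_∘_)
  open import Relation.Binary.PropositionalEquality

  fromℕ : ℕ → ℚ
  fromℕ n = + n ℚ./ 1

  private
    fraction : ∀ n d .{{_ : ℕ.NonZero d}} → toℚᵘ (+ n ℚ./ d) ℚᵘ.≃ (+ n ℚᵘ./ d)
    fraction n (suc d) = toℚᵘ-fromℚᵘ (mkℚᵘ (+ n) d)

  fromℕ-+ : ∀ m n → fromℕ (m ℕ.+ n) ≡ fromℕ m + fromℕ n
  fromℕ-+ m n = toℚᵘ-injective (begin
    toℚᵘ (fromℕ (m ℕ.+ n))             ≈⟨ fraction (m ℕ.+ n) 1 ⟩
    mkℚᵘ (+ (m ℕ.+ n)) 0               ≈⟨ ℚᵘ.*≡* (cong (ℤ._* + 1) (sym (cong₂ ℤ._+_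
                                            (ℤ.*-identityʳ (+ m)) (ℤ.*-identityʳ (+ n))))) ⟩
    mkℚᵘ (+ m) 0 ℚᵘ.+ mkℚᵘ (+ n) 0     ≈⟨ ℚᵘ.+-cong (fraction m 1) (fraction n 1) ⟨
    toℚᵘ (fromℕ m) ℚᵘ.+ toℚᵘ (fromℕ n) ≈⟨ toℚᵘ-homo-+ (fromℕ m) (fromℕ n) ⟨
    toℚᵘ (fromℕ m + fromℕ n)           ∎)
    where open ℚᵘ.≃-Reasoning

  fromℕ-* : ∀ m n → fromℕ (m ℕ.* n) ≡ fromℕ m * fromℕ n
  fromℕ-* m n = toℚᵘ-injective (begin
    toℚᵘ (fromℕ (m ℕ.* n))             ≈⟨ fraction (m ℕ.* n) 1 ⟩
    mkℚᵘ (+ (m ℕ.* n)) 0               ≈⟨ ℚᵘ.*≡* (cong (ℤ._* + 1) (ℤ.pos-* m n)) ⟩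
    mkℚᵘ (+ m) 0 ℚᵘ.* mkℚᵘ (+ n) 0     ≈⟨ ℚᵘ.*-cong (fraction m 1) (fraction n 1) ⟨
    toℚᵘ (fromℕ m) ℚᵘ.* toℚᵘ (fromℕ n) ≈⟨ toℚᵘ-homo-* (fromℕ m) (fromℕ n) ⟨
    toℚᵘ (fromℕ m * fromℕ n)           ∎)
    where open ℚᵘ.≃-Reasoning

  fromℕ-mono : ∀ {m n} → m ℕ.≤ n → fromℕ m ≤ fromℕ n
  fromℕ-mono {m} {n} m≤n = toℚᵘ-cancel-≤ (begin
    toℚᵘ (fromℕ m)  ≃⟨ fraction m 1 ⟩
    mkℚᵘ (+ m) 0    ≤⟨ ℚᵘ.*≤* (ℤ.*-monoʳ-≤-nonNeg (+ 1) (ℤ.+≤+ m≤n)) ⟩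
    mkℚᵘ (+ n) 0    ≃⟨ fraction n 1 ⟨
    toℚᵘ (fromℕ n)  ∎)
    where open ℚᵘ.≤-Reasoning

  fromℕ-nonNeg : ∀ {n} → NonNegative (fromℕ n)
  fromℕ-nonNeg {n} = normalize-nonNeg n 1

  1/2^-nonNeg : ∀ {n} → NonNegative (1/2^ n)
  1/2^-nonNeg {n} = normalize-nonNeg 1 (2 ℕ.^ n) {{ℕ.m^n≢0 2 n}}

  reciprocal : ∀ n .{{_ : ℕ.NonZero n}} → (+ 1 ℚ./ n) * fromℕ n ≡ 1ℚ
  reciprocal n@(suc n-1) = toℚᵘ-injective (begin
    toℚᵘ ((+ 1 ℚ./ n) * fromℕ n)            ≈⟨ toℚᵘ-homo-* (+ 1 ℚ./ n) (fromℕ n) ⟩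
    toℚᵘ (+ 1 ℚ./ n) ℚᵘ.* toℚᵘ (fromℕ n)    ≈⟨ ℚᵘ.*-cong (fraction 1 n) (fraction n 1) ⟩
    mkℚᵘ (+ 1) n-1 ℚᵘ.* mkℚᵘ (+ n) 0
      ≈⟨ ℚᵘ.*≡* (cong (+_ ∘ suc) (trans (cong (ℕ._* 1) (ℕ.+-identityʳ n-1))
                                        (sym (ℕ.+-identityʳ (n-1 ℕ.* 1))))) ⟩
    mkℚᵘ (+ 1) 0                            ∎)
    where open ℚᵘ.≃-Reasoning

  1/2^-2^ : ∀ m n → 1/2^ m * 2^ (m ℕ.+ n) ≡ 2^ n
  1/2^-2^ m n = begin
    1/2^ m * 2^ (m ℕ.+ n)      ≡⟨ cong (λ e → 1/2^ m * fromℕ e) (ℕ.^-distribˡ-+-* 2 m n) ⟩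
    1/2^ m * fromℕ (2 ℕ.^ m ℕ.* 2 ℕ.^ n)  ≡⟨ cong (1/2^ m *_) (fromℕ-* (2 ℕ.^ m) (2 ℕ.^ n)) ⟩
    1/2^ m * (2^ m * 2^ n)     ≡⟨ sym (*-assoc (1/2^ m) (2^ m) (2^ n)) ⟩
    1/2^ m * 2^ m * 2^ n       ≡⟨ cong (_* 2^ n) (reciprocal (2 ℕ.^ m) {{ℕ.m^n≢0 2 m}}) ⟩
    1ℚ * 2^ n                  ≡⟨ *-identityˡ (2^ n) ⟩
    2^ n                       ∎
    where open ≡-Reasoning

  1/2^-suc : ∀ n → 1/2^ n ≡ 1/2^ (suc n) + 1/2^ (suc n)
  1/2^-suc n = begin
    1/2^ n                               ≡⟨ sym (*-identityˡ (1/2^ n)) ⟩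
    1ℚ * 1/2^ n
      ≡⟨ cong (_* 1/2^ n) (sym (reciprocal (2 ℕ.^ suc n) {{ℕ.m^n≢0 2 (suc n)}})) ⟩
    1/2^ (suc n) * 2^ (suc n) * 1/2^ n   ≡⟨ cong (λ p → 1/2^ (suc n) * p * 1/2^ n) (fromℕ-* 2 (2 ℕ.^ n)) ⟩
    1/2^ (suc n) * (fromℕ 2 * 2^ n) * 1/2^ n
      ≡⟨ solve 4 (λ a t b c → (a :* (t :* b)) :* c := (a :* t) :* (c :* b)) refl
           (1/2^ (suc n)) (fromℕ 2) (2^ n) (1/2^ n) ⟩
    1/2^ (suc n) * fromℕ 2 * (1/2^ n * 2^ n)
      ≡⟨ cong (1/2^ (suc n) * fromℕ 2 *_) (reciprocal (2 ℕ.^ n) {{ℕ.m^n≢0 2 n}}) ⟩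
    1/2^ (suc n) * fromℕ 2 * 1ℚ
      ≡⟨ solve 1 (λ a → (a :* con (fromℕ 2)) :* con 1ℚ := a :+ a) refl (1/2^ (suc n)) ⟩
    1/2^ (suc n) + 1/2^ (suc n)          ∎
    where
    open ≡-Reasoning
    open +-*-Solver

  p≤p+q : ∀ p q .{{_ : NonNegative q}} → p ≤ p + q
  p≤p+q p q = subst (_≤ p + q) (+-identityʳ p) (+-monoʳ-≤ p (nonNegative⁻¹ q))

  1/2^-antimono : ∀ {m n} → m ℕ.≤ n → 1/2^ n ≤ 1/2^ m
  1/2^-antimono {m} m≤n = go (ℕ.≤⇒≤′ m≤n)
    where
    go : ∀ {n} → m ℕ.≤′ n → 1/2^ n ≤ 1/2^ m
    go ℕ.≤′-refl          = ≤-refl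
    go (ℕ.≤′-step {n} m≤n) =
      ≤-trans (subst (1/2^ (suc n) ≤_) (sym (1/2^-suc n))
                 (p≤p+q (1/2^ (suc n)) (1/2^ (suc n)) {{1/2^-nonNeg {suc n}}}))
              (go m≤n)

  p≤q⇒0≤q-p : ∀ {p q} → p ≤ q → 0ℚ ≤ q - p
  p≤q⇒0≤q-p {p} {q} p≤q = subst (_≤ q - p) (+-inverseʳ p) (+-monoˡ-≤ (- p) p≤q)

  -- Finite sums of rationals.

  ∑₁-mono : ∀ n {f g} → (∀ j → 1 ℕ.≤ j → j ℕ.≤ n → f j ≤ g j) → ∑₁ n f ≤ ∑₁ n g
  ∑₁-mono zero    f≤g = ≤-refl
  ∑₁-mono (suc n) f≤g = +-mono-≤ (∑₁-mono n λ j 1≤j j≤n → f≤g j 1≤j (ℕ.m≤n⇒m≤1+n j≤n))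
                                 (f≤g (suc n) (ℕ.s≤s ℕ.z≤n) ℕ.≤-refl)

  ∑₁-cong : ∀ n {f g} → (∀ j → f j ≡ g j) → ∑₁ n f ≡ ∑₁ n g
  ∑₁-cong zero    f≡g = refl
  ∑₁-cong (suc n) f≡g = cong₂ _+_ (∑₁-cong n f≡g) (f≡g (suc n))

  ∑₁-minus : ∀ n f g → ∑₁ n (λ j → f j - g j) ≡ ∑₁ n f - ∑₁ n g
  ∑₁-minus zero    f g = refl
  ∑₁-minus (suc n) f g = trans (cong (_+ (f (suc n) - g (suc n))) (∑₁-minus n f g))
    (solve 4 (λ F G x y → (F :- G) :+ (x :- y) := (F :+ x) :- (G :+ y)) refl
       (∑₁ n f) (∑₁ n g) (f (suc n)) (g (suc n)))
    where open +-*-Solver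

  ∑₁-*ˡ : ∀ n c f → ∑₁ n (λ j → c * f j) ≡ c * ∑₁ n f
  ∑₁-*ˡ zero    c f = sym (*-zeroʳ c)
  ∑₁-*ˡ (suc n) c f = trans (cong (_+ c * f (suc n)) (∑₁-*ˡ n c f)) (sym (*-distribˡ-+ c (∑₁ n f) (f (suc n))))

  ∑₁-*ʳ : ∀ n c f → ∑₁ n (λ j → f j * c) ≡ ∑₁ n f * c
  ∑₁-*ʳ n c f = trans (∑₁-cong n (λ j → *-comm (f j) c)) (trans (∑₁-*ˡ n c f) (*-comm c (∑₁ n f)))

  -- The last `b` terms are read backwards, so that term `a + b + 1 - j` stands at index `j`, that
  -- of the layer with which it will be paired.
  ∑₁-reverse-tail : ∀ a b f → ∑₁ (a ℕ.+ b) f ≡ ∑₁ a f + ∑₁ b (λ j → f (suc (a ℕ.+ b) ℕ.∸ j))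
  ∑₁-reverse-tail a zero    f =
    trans (cong (λ n → ∑₁ n f) (ℕ.+-identityʳ a)) (sym (+-identityʳ (∑₁ a f)))
  ∑₁-reverse-tail a (suc b) f rewrite ℕ.+-suc a b = begin
    ∑₁ (suc a ℕ.+ b) f
      ≡⟨ ∑₁-reverse-tail (suc a) b f ⟩
    ∑₁ a f + f (suc a) + R
      ≡⟨ solve 3 (λ x y z → (x :+ y) :+ z := x :+ (z :+ y)) refl (∑₁ a f) (f (suc a)) R ⟩
    ∑₁ a f + (R + f (suc a))
      ≡⟨ cong (λ n → ∑₁ a f + (R + f n)) (sym (ℕ.m+n∸n≡m (suc a) b)) ⟩
    ∑₁ a f + (R + f (suc a ℕ.+ b ℕ.∸ b)) ∎
    where
    open ≡-Reasoning
    open +-*-Solver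
    R = ∑₁ b (λ j → f (suc (suc a ℕ.+ b) ℕ.∸ j))

  -- The exponents in the sum run from `a + b + 1` down to `a + 2`; the extra copy of the smallest
  -- power lets everything collapse by repeated doubling.
  ∑₁-1/2^ : ∀ a b → ∑₁ b (λ j → 1/2^ (suc (suc (a ℕ.+ b)) ℕ.∸ j)) + 1/2^ (suc (a ℕ.+ b)) ≡ 1/2^ (suc a)
  ∑₁-1/2^ a zero    = trans (+-identityˡ _) (cong (λ n → 1/2^ (suc n)) (ℕ.+-identityʳ a))
  ∑₁-1/2^ a (suc b) rewrite ℕ.+-suc a b = begin
    R + 1/2^ (suc (suc a ℕ.+ b) ℕ.∸ b) + x
      ≡⟨ cong (λ n → R + 1/2^ n + x) (ℕ.m+n∸n≡m (suc (suc a)) b) ⟩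
    R + 1/2^ (suc (suc a)) + x
      ≡⟨ solve 3 (λ r y z → (r :+ y) :+ z := (r :+ z) :+ y) refl R (1/2^ (suc (suc a))) x ⟩
    R + x + 1/2^ (suc (suc a))
      ≡⟨ cong (_+ 1/2^ (suc (suc a))) (∑₁-1/2^ (suc a) b) ⟩
    1/2^ (suc (suc a)) + 1/2^ (suc (suc a))
      ≡⟨ sym (1/2^-suc (suc a)) ⟩
    1/2^ (suc a) ∎
    where
    open ≡-Reasoning
    open +-*-Solver
    R = ∑₁ b (λ j → 1/2^ (suc (suc (suc a ℕ.+ b)) ℕ.∸ j))
    x = 1/2^ (suc (suc a ℕ.+ b))

  -- Each step of the recursion of `horner` doubles what came before, which the additional factor
  -- one half undoes.
  horner-∑₁ : ∀ J S → 1/2^ (suc J) * fromℕ (Words.horner J S) ≡ ∑₁ J (λ j → 1/2^ (j ℕ.+ 1) * fromℕ (S j))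
  horner-∑₁ zero    S = refl
  horner-∑₁ (suc J) S = begin
    h * fromℕ (2 ℕ.* G ℕ.+ S (suc J))
      ≡⟨ cong (h *_) (trans (fromℕ-+ (2 ℕ.* G) (S (suc J))) (cong (_+ s) (fromℕ-* 2 G))) ⟩
    h * (fromℕ 2 * fromℕ G + s)
      ≡⟨ solve 3 (λ x g y → x :* (con (fromℕ 2) :* g :+ y) := (x :+ x) :* g :+ x :* y) refl h (fromℕ G) s ⟩
    (h + h) * fromℕ G + h * s
      ≡⟨ cong (λ p → p * fromℕ G + h * s) (sym (1/2^-suc (suc J))) ⟩
    1/2^ (suc J) * fromℕ G + h * s
      ≡⟨ cong₂ (λ p n → p + 1/2^ n * s) (horner-∑₁ J S) (sym (ℕ.+-comm (suc J) 1)) ⟩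
    ∑₁ (suc J) (λ j → 1/2^ (j ℕ.+ 1) * fromℕ (S j)) ∎
    where
    open ≡-Reasoning
    open +-*-Solver
    h = 1/2^ (suc (suc J))
    G = Words.horner J S
    s = fromℕ (S (suc J))

  ∑₀-binomial : ∀ d k → ∑₀ k (λ j → fromℕ (d C j)) ≡ fromℕ (Hypercube.card (Hypercube.ball k d))
  ∑₀-binomial d zero    = trans (+-identityʳ (fromℕ (d C 0))) (cong fromℕ (sym (Words.card-ball-0 d)))
  ∑₀-binomial d (suc k) = begin
    fromℕ (d C 0) + (∑₁ k (λ j → fromℕ (d C j)) + fromℕ (d C suc k))
      ≡⟨ sym (+-assoc (fromℕ (d C 0)) (∑₁ k (λ j → fromℕ (d C j))) (fromℕ (d C suc k))) ⟩
    ∑₀ k (λ j → fromℕ (d C j)) + fromℕ (d C suc k)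
      ≡⟨ cong (_+ fromℕ (d C suc k)) (∑₀-binomial d k) ⟩
    fromℕ (card (ball k d)) + fromℕ (d C suc k)
      ≡⟨ sym (fromℕ-+ (card (ball k d)) (d C suc k)) ⟩
    fromℕ (card (ball k d) ℕ.+ d C suc k)
      ≡⟨ cong fromℕ (sym (Words.card-ball-binomial k d)) ⟩
    fromℕ (card (ball (suc k) d)) ∎
    where
    open ≡-Reasoning
    open Hypercube using (card; ball)

-- Bounds on the number of words and of boxes.

module Bounds where
  open Rationals
  open Words
  open import Data.Fin using (Fin)
  open import Data.Fin.Properties using (any?)
  open import Data.Product using (_,_)
  open import Relation.Nullary using (yes; no)
  open import Relation.Nullary.Decidable using (decidable-stable)
  open import Data.List using (length)
  open import Data.Nat using (zero; suc)
  open import Data.Nat.DivMod using (m*n/n≡m)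
  import Data.Nat.Properties as ℕ
  open import Data.Nat.Tactic.RingSolver using (solve-∀)
  open import Data.Rational using (ℚ; 0ℚ; 1ℚ; _≤_; nonNegative)
  open import Data.Rational.Properties
  open import Data.Rational.Solver using (module +-*-Solver)
  open import Relation.Binary.PropositionalEquality

  -- Here `T` stands for `d - k`. The first power is the weight of S(j) in the summation by parts;
  -- the second is subtracted because a large layer `j` forces its partner, layer `T - 1 - j`, to be
  -- small.
  coefficient : ℕ → ℕ → ℚ
  coefficient T j = 1/2^ (j ℕ.+ 1) - 1/2^ (T ℕ.∸ j)

  module _ {k N d} {w : Fin N → Word d} (nw : NeighborlyWords k w) (1≤stars : ∀ i → 1 ℕ.≤ stars (w i)) where
    private
      V : ℕ → ℚ
      V j = fromℕ (volume nw j)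


    layered-bound : ∀ J → fromℕ N ≤ ∑₁ J (λ j → 1/2^ (j ℕ.+ 1) * V j) + 1/2^ (suc J) * 2^ d
    layered-bound J = begin
      fromℕ N                                ≡⟨ sym (*-identityˡ (fromℕ N)) ⟩
      1ℚ * fromℕ N                           ≡⟨ cong (_* fromℕ N) (sym
                                                  (reciprocal (2 ℕ.^ suc J) {{ℕ.m^n≢0 2 (suc J)}})) ⟩
      h * 2^ (suc J) * fromℕ N               ≡⟨ *-assoc h (2^ (suc J)) (fromℕ N) ⟩
      h * (2^ (suc J) * fromℕ N)             ≡⟨ cong (h *_) (trans (*-comm (2^ (suc J)) (fromℕ N))
                                                  (sym (fromℕ-* N (2 ℕ.^ suc J)))) ⟩
      h * fromℕ (N ℕ.* 2 ℕ.^ suc J)          ≤⟨ *-monoˡ-≤-nonNeg h {{1/2^-nonNeg {suc J}}}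
                                                  (fromℕ-mono (horner-bound nw 1≤stars J)) ⟩
      h * fromℕ (H ℕ.+ 2 ℕ.^ d)              ≡⟨ cong (h *_) (fromℕ-+ H (2 ℕ.^ d)) ⟩
      h * (fromℕ H + 2^ d)                   ≡⟨ *-distribˡ-+ h (fromℕ H) (2^ d) ⟩
      h * fromℕ H + h * 2^ d                 ≡⟨ cong (_+ h * 2^ d) (horner-∑₁ J (volume nw)) ⟩
      ∑₁ J (λ j → 1/2^ (j ℕ.+ 1) * V j) + h * 2^ d ∎
      where
      open ≤-Reasoning
      h = 1/2^ (suc J)
      H = horner J (volume nw)

    -- With `T = a + b + 2` equal to `d - k`, `layered-bound` is taken at `J = T - 2`. The layers
    -- above `a` are bounded through their partners, and the resulting multiples of `2 ^ d` add up
    -- to `2 ^ d / 2 ^ (a + 1)`.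
    paired-bound : ∀ a b → d ≡ k ℕ.+ suc (suc (a ℕ.+ b)) →
                   fromℕ N ≤ ∑₁ a (λ j → 1/2^ (j ℕ.+ 1) * V j)
                             - ∑₁ b (λ j → 1/2^ (suc (suc (a ℕ.+ b)) ℕ.∸ j) * V j)
                             + 1/2^ (suc a) * 2^ d
    paired-bound a b d≡ = begin
      fromℕ N
        ≤⟨ layered-bound (a ℕ.+ b) ⟩
      ∑₁ (a ℕ.+ b) f + h * 2^ d
        ≡⟨ cong (_+ h * 2^ d) (∑₁-reverse-tail a b f) ⟩
      ∑₁ a f + ∑₁ b (λ j → f (suc (a ℕ.+ b) ℕ.∸ j)) + h * 2^ d
        ≤⟨ +-monoˡ-≤ (h * 2^ d) (+-monoʳ-≤ (∑₁ a f) (∑₁-mono b paired)) ⟩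
      ∑₁ a f + ∑₁ b (λ j → c j * 2^ d - c j * V j) + h * 2^ d
        ≡⟨ cong (λ p → ∑₁ a f + p + h * 2^ d) (trans (∑₁-minus b (λ j → c j * 2^ d) (λ j → c j * V j))
             (cong (_- G) (∑₁-*ʳ b (2^ d) c))) ⟩
      ∑₁ a f + (∑₁ b c * 2^ d - G) + h * 2^ d
        ≡⟨ solve 5 (λ F Σc Q g x → (F :+ (Σc :* Q :- g)) :+ x :* Q := (F :- g) :+ (Σc :+ x) :* Q) refl
             (∑₁ a f) (∑₁ b c) (2^ d) G h ⟩
      ∑₁ a f - G + (∑₁ b c + h) * 2^ d
        ≡⟨ cong (λ p → ∑₁ a f - G + p * 2^ d) (∑₁-1/2^ a b) ⟩
      ∑₁ a f - G + 1/2^ (suc a) * 2^ d ∎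
      where
      open ≤-Reasoning
      open +-*-Solver
      f c : ℕ → ℚ
      f j = 1/2^ (j ℕ.+ 1) * V j
      c j = 1/2^ (suc (suc (a ℕ.+ b)) ℕ.∸ j)
      h = 1/2^ (suc (a ℕ.+ b))
      G = ∑₁ b (λ j → c j * V j)
      paired : ∀ j → 1 ℕ.≤ j → j ℕ.≤ b → f (suc (a ℕ.+ b) ℕ.∸ j) ≤ c j * 2^ d - c j * V j
      paired j _ j≤b = begin
        -- The partner of `j` is `j′ = T - 1 - j`, so its weight has exponent `j′ + 1 = T - j`.
        1/2^ (j′ ℕ.+ 1) * V j′   ≡⟨ cong (λ n → 1/2^ n * V j′)
                                      (trans (ℕ.+-comm j′ 1) (sym (ℕ.+-∸-assoc 1 j≤))) ⟩
        c j * V j′               ≤⟨ *-monoˡ-≤-nonNeg (c j) {{1/2^-nonNeg {suc (suc (a ℕ.+ b)) ℕ.∸ j}}} V′≤ ⟩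
        c j * (2^ d - V j)       ≡⟨ solve 3 (λ x Q v → x :* (Q :- v) := x :* Q :- x :* v) refl
                                      (c j) (2^ d) (V j) ⟩
        c j * 2^ d - c j * V j   ∎
        where
        j′ = suc (a ℕ.+ b) ℕ.∸ j
        j≤ : j ℕ.≤ suc (a ℕ.+ b)
        j≤ = ℕ.≤-trans j≤b (ℕ.≤-trans (ℕ.m≤n+m b a) (ℕ.n≤1+n _))
        small : k ℕ.+ (j ℕ.+ j′) ℕ.< d
        small = ℕ.≤-reflexive (trans (cong (λ n → suc (k ℕ.+ n)) (ℕ.m+[n∸m]≡n j≤))
                                     (trans (sym (ℕ.+-suc k _)) (sym d≡)))
        V′≤ : V j′ ≤ 2^ d - V j
        V′≤ = begin
          V j′                 ≡⟨ solve 2 (λ x y → y := (x :+ y) :- x) refl (V j) (V j′) ⟩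
          V j + V j′ - V j     ≡⟨ cong (_- V j) (sym (fromℕ-+ (volume nw j) (volume nw j′))) ⟩
          fromℕ (volume nw j ℕ.+ volume nw j′) - V j
            ≤⟨ +-monoˡ-≤ (ℚ.- V j) (fromℕ-mono (volume+volume nw j j′ small)) ⟩
          2^ d - V j           ∎

    kleitman-terms : ∀ T b → b ℕ.+ b ℕ.< T → d ≡ k ℕ.+ T →
      ∑₁ b (λ j → 1/2^ (j ℕ.+ 1) * V j) - ∑₁ b (λ j → 1/2^ (T ℕ.∸ j) * V j)
      ≤ ∑₁ b (λ j → coefficient T j * ∣B∣ (k ℕ.+ 2 ℕ.* j) d)
    kleitman-terms T b 2b<T d≡ = begin
      ∑₁ b (λ j → 1/2^ (j ℕ.+ 1) * V j) - ∑₁ b (λ j → 1/2^ (T ℕ.∸ j) * V j)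
        ≡⟨ sym (∑₁-minus b (λ j → 1/2^ (j ℕ.+ 1) * V j) (λ j → 1/2^ (T ℕ.∸ j) * V j)) ⟩
      ∑₁ b (λ j → 1/2^ (j ℕ.+ 1) * V j - 1/2^ (T ℕ.∸ j) * V j)
        ≤⟨ ∑₁-mono b term ⟩
      ∑₁ b (λ j → coefficient T j * ∣B∣ (k ℕ.+ 2 ℕ.* j) d) ∎
      where
      open ≤-Reasoning
      open +-*-Solver
      term : ∀ j → 1 ℕ.≤ j → j ℕ.≤ b →
             1/2^ (j ℕ.+ 1) * V j - 1/2^ (T ℕ.∸ j) * V j ≤ coefficient T j * ∣B∣ (k ℕ.+ 2 ℕ.* j) d
      term j _ j≤b = begin
        1/2^ (j ℕ.+ 1) * V j - 1/2^ (T ℕ.∸ j) * V j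
          ≡⟨ solve 3 (λ x y v → x :* v :- y :* v := (x :- y) :* v) refl
               (1/2^ (j ℕ.+ 1)) (1/2^ (T ℕ.∸ j)) (V j) ⟩
        coefficient T j * V j
          -- From `b + b < T` follow `j + 1 ≤ T - j`, which makes the coefficient nonnegative, and
          -- `k + 2j < d`, which Kleitman's theorem requires.
          ≤⟨ *-monoˡ-≤-nonNeg (coefficient T j)
               {{nonNegative (p≤q⇒0≤q-p (1/2^-antimono (ℕ.m+n≤o⇒m≤o∸n (j ℕ.+ 1) 2j<T)))}}
               (fromℕ-mono (volume≤B nw j 2j<)) ⟩
        coefficient T j * ∣B∣ (k ℕ.+ 2 ℕ.* j) d ∎
        where
        2j<T : j ℕ.+ 1 ℕ.+ j ℕ.≤ T
        2j<T = subst (ℕ._≤ T) (cong (ℕ._+ j) (ℕ.+-comm 1 j))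
                 (ℕ.≤-trans (ℕ.s≤s (ℕ.+-mono-≤ j≤b j≤b)) 2b<T)
        2j< : k ℕ.+ 2 ℕ.* j ℕ.< d
        2j< = subst (k ℕ.+ 2 ℕ.* j ℕ.<_) (sym d≡) (ℕ.+-monoʳ-< k
                (subst (ℕ._< T) (cong (j ℕ.+_) (sym (ℕ.+-identityʳ j)))
                  (ℕ.≤-trans (ℕ.s≤s (ℕ.+-mono-≤ j≤b j≤b)) 2b<T)))

    private
      halve : ∀ {m} n → m ≡ n ℕ.* 2 → m / 2 ≡ n
      halve n refl = m*n/n≡m n 2

    -- The layers from 1 to `T - 2` split into pairs `j` and `T - 1 - j` with `j ≤ t`, so
    -- `paired-bound` is used with `a = b = t`.
    star-bound-even : ∀ t T → T ≡ suc t ℕ.* 2 → d ≡ k ℕ.+ T →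
      fromℕ N ≤ ∑₁ ((T ℕ.∸ 2) / 2) (λ j → coefficient T j * ∣B∣ (k ℕ.+ 2 ℕ.* j) d) + 2^ ((d ℕ.+ k) / 2)
    star-bound-even t T T≡ d≡ = begin
      fromℕ N
        ≤⟨ paired-bound t t (trans d≡ (cong (k ℕ.+_) T≡′)) ⟩
      ∑₁ t f - ∑₁ t (λ j → 1/2^ (suc (suc (t ℕ.+ t)) ℕ.∸ j) * V j) + 1/2^ (suc t) * 2^ d
        ≡⟨ cong (λ m → ∑₁ t f - ∑₁ t (λ j → 1/2^ (m ℕ.∸ j) * V j) + 1/2^ (suc t) * 2^ d) (sym T≡′) ⟩
      ∑₁ t f - ∑₁ t (λ j → 1/2^ (T ℕ.∸ j) * V j) + 1/2^ (suc t) * 2^ d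
        ≤⟨ +-monoˡ-≤ (1/2^ (suc t) * 2^ d) (kleitman-terms T t
             (subst (t ℕ.+ t ℕ.<_) (sym T≡′) (ℕ.n≤1+n _)) d≡) ⟩
      ∑₁ t g + 1/2^ (suc t) * 2^ d
        ≡⟨ cong (λ m → ∑₁ t g + 1/2^ (suc t) * 2^ m) d≡split ⟩
      ∑₁ t g + 1/2^ (suc t) * 2^ (suc t ℕ.+ (k ℕ.+ suc t))
        ≡⟨ cong (λ p → ∑₁ t g + p) (1/2^-2^ (suc t) (k ℕ.+ suc t)) ⟩
      ∑₁ t g + 2^ (k ℕ.+ suc t)
        ≡⟨ cong₂ (λ m n → ∑₁ m g + 2^ n) (sym (halve t (cong (ℕ._∸ 2) T≡))) (sym (halve (k ℕ.+ suc t) d+k≡)) ⟩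
      ∑₁ ((T ℕ.∸ 2) / 2) g + 2^ ((d ℕ.+ k) / 2) ∎
      where
      open ≤-Reasoning
      f g : ℕ → ℚ
      f j = 1/2^ (j ℕ.+ 1) * V j
      g j = coefficient T j * ∣B∣ (k ℕ.+ 2 ℕ.* j) d
      T≡′ : T ≡ suc (suc (t ℕ.+ t))
      T≡′ = trans T≡ (double t)
        where
        double : ∀ t → suc t ℕ.* 2 ≡ suc (suc (t ℕ.+ t))
        double = solve-∀
      d≡split : d ≡ suc t ℕ.+ (k ℕ.+ suc t)
      d≡split = trans d≡ (trans (cong (k ℕ.+_) T≡) (split k t))
        where
        split : ∀ k t → k ℕ.+ suc t ℕ.* 2 ≡ suc t ℕ.+ (k ℕ.+ suc t)
        split = solve-∀
      d+k≡ : d ℕ.+ k ≡ (k ℕ.+ suc t) ℕ.* 2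
      d+k≡ = trans (cong (ℕ._+ k) (trans d≡ (cong (k ℕ.+_) T≡))) (split k t)
        where
        split : ∀ k t → k ℕ.+ suc t ℕ.* 2 ℕ.+ k ≡ (k ℕ.+ suc t) ℕ.* 2
        split = solve-∀

    -- The layer `(T - 1) / 2` is its own partner. Its diameter is at most `d - 1`, and Kleitman's
    -- theorem applied to it directly gives the term with `∣B∣ (d ∸ 1) d`; hence `a = b + 1` in
    -- `paired-bound`.
    star-bound-odd : ∀ t T → T ≡ suc (t ℕ.* 2) → d ≡ k ℕ.+ T →
      fromℕ N ≤ ∑₁ ((T ℕ.∸ 3) / 2) (λ j → coefficient T j * ∣B∣ (k ℕ.+ 2 ℕ.* j) d)
                + 1/2^ ((T ℕ.+ 1) / 2) * ∣B∣ (d ℕ.∸ 1) d + 2^ ((d ℕ.+ k ℕ.∸ 1) / 2)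
    -- For `T = 1` there is no layer to sum and `2 ^ k` is already a bound. Truncation of `T ∸ 3`
    -- makes the sum empty, and the configuration term is added as a nonnegative quantity.
    star-bound-odd zero T refl d≡ = begin
      fromℕ N
        ≤⟨ layered-bound 0 ⟩
      0ℚ + 1/2^ 1 * 2^ d
        ≡⟨ cong (λ p → 0ℚ + p) (trans (cong (λ m → 1/2^ 1 * 2^ m) (trans d≡ (ℕ.+-comm k 1))) (1/2^-2^ 1 k)) ⟩
      0ℚ + 2^ k
        ≤⟨ +-monoˡ-≤ (2^ k) (subst (_≤ 0ℚ + x) (+-identityʳ 0ℚ) (+-monoʳ-≤ 0ℚ
             (subst (_≤ x) (*-zeroʳ (1/2^ 1))
               (*-monoˡ-≤-nonNeg (1/2^ 1) {{1/2^-nonNeg {1}}} (nonNegative⁻¹ (∣B∣ (d ℕ.∸ 1) d)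
                 {{fromℕ-nonNeg {length (B (d ℕ.∸ 1) d)}}}))))) ⟩
      0ℚ + x + 2^ k
        ≡⟨ cong (λ n → 0ℚ + x + 2^ n) (sym (halve k (cong (ℕ._∸ 1) (trans (cong (ℕ._+ k) d≡) (split k))))) ⟩
      0ℚ + x + 2^ ((d ℕ.+ k ℕ.∸ 1) / 2) ∎
      where
      open ≤-Reasoning
      x = 1/2^ 1 * ∣B∣ (d ℕ.∸ 1) d
      split : ∀ k → k ℕ.+ 1 ℕ.+ k ≡ suc (k ℕ.* 2)
      split = solve-∀
    star-bound-odd (suc t) T T≡ d≡ = begin
      fromℕ N
        ≤⟨ paired-bound (suc t) t (trans d≡ (cong (k ℕ.+_) T≡′)) ⟩
      ∑₁ (suc t) f - ∑₁ t (λ j → 1/2^ (suc (suc (suc t ℕ.+ t)) ℕ.∸ j) * V j) + q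
        ≡⟨ cong (λ m → ∑₁ (suc t) f - ∑₁ t (λ j → 1/2^ (m ℕ.∸ j) * V j) + q) (sym T≡′) ⟩
      ∑₁ t f + f (suc t) - G + q
        ≡⟨ solve 4 (λ F y z u → ((F :+ y) :- z) :+ u := ((F :- z) :+ y) :+ u) refl (∑₁ t f) (f (suc t)) G q ⟩
      ∑₁ t f - G + f (suc t) + q
        ≤⟨ +-monoˡ-≤ q (+-mono-≤ (kleitman-terms T t 2t<T d≡)
             (*-monoˡ-≤-nonNeg (1/2^ (suc t ℕ.+ 1)) {{1/2^-nonNeg {suc t ℕ.+ 1}}}
               (fromℕ-mono (volume≤B nw (suc t) (ℕ.≤-reflexive (sym d≡middle)))))) ⟩
      ∑₁ t g + 1/2^ (suc t ℕ.+ 1) * ∣B∣ (k ℕ.+ 2 ℕ.* suc t) d + q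
        ≡⟨ cong₂ (λ m n → ∑₁ t g + 1/2^ m * ∣B∣ n d + q) (sym (halve (suc t ℕ.+ 1) T+1≡))
             (sym (cong (ℕ._∸ 1) d≡middle)) ⟩
      ∑₁ t g + y + q
        ≡⟨ cong (λ p → ∑₁ t g + y + p) (trans (cong (λ m → 1/2^ (suc (suc t)) * 2^ m) d≡split)
             (1/2^-2^ (suc (suc t)) (k ℕ.+ suc t))) ⟩
      ∑₁ t g + y + 2^ (k ℕ.+ suc t)
        ≡⟨ cong₂ (λ m n → ∑₁ m g + y + 2^ n) (sym (halve t (cong (ℕ._∸ 3) T≡)))
             (sym (halve (k ℕ.+ suc t) (cong (ℕ._∸ 1) d+k≡))) ⟩
      ∑₁ ((T ℕ.∸ 3) / 2) g + y + 2^ ((d ℕ.+ k ℕ.∸ 1) / 2) ∎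
      where
      open ≤-Reasoning
      open +-*-Solver
      f g : ℕ → ℚ
      f j = 1/2^ (j ℕ.+ 1) * V j
      g j = coefficient T j * ∣B∣ (k ℕ.+ 2 ℕ.* j) d
      q = 1/2^ (suc (suc t)) * 2^ d
      y = 1/2^ ((T ℕ.+ 1) / 2) * ∣B∣ (d ℕ.∸ 1) d
      G = ∑₁ t (λ j → 1/2^ (T ℕ.∸ j) * V j)
      d≡′ : d ≡ k ℕ.+ suc (suc t ℕ.* 2)
      d≡′ = trans d≡ (cong (k ℕ.+_) T≡)
      T≡′ : T ≡ suc (suc (suc t ℕ.+ t))
      T≡′ = trans T≡ (double t)
        where
        double : ∀ t → suc (suc t ℕ.* 2) ≡ suc (suc (suc t ℕ.+ t))
        double = solve-∀
      2t<T : t ℕ.+ t ℕ.< T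
      2t<T = subst (t ℕ.+ t ℕ.<_) (sym T≡′) (ℕ.m≤n+m (suc (t ℕ.+ t)) 2)
      T+1≡ : T ℕ.+ 1 ≡ (suc t ℕ.+ 1) ℕ.* 2
      T+1≡ = trans (cong (ℕ._+ 1) T≡) (split t)
        where
        split : ∀ t → suc (suc t ℕ.* 2) ℕ.+ 1 ≡ (suc t ℕ.+ 1) ℕ.* 2
        split = solve-∀
      d≡middle : d ≡ suc (k ℕ.+ 2 ℕ.* suc t)
      d≡middle = trans d≡′ (split k t)
        where
        split : ∀ k t → k ℕ.+ suc (suc t ℕ.* 2) ≡ suc (k ℕ.+ 2 ℕ.* suc t)
        split = solve-∀
      d≡split : d ≡ suc (suc t) ℕ.+ (k ℕ.+ suc t)
      d≡split = trans d≡′ (split k t)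
        where
        split : ∀ k t → k ℕ.+ suc (suc t ℕ.* 2) ≡ suc (suc t) ℕ.+ (k ℕ.+ suc t)
        split = solve-∀
      d+k≡ : d ℕ.+ k ≡ suc ((k ℕ.+ suc t) ℕ.* 2)
      d+k≡ = trans (cong (ℕ._+ k) d≡′) (split k t)
        where
        split : ∀ k t → k ℕ.+ suc (suc t ℕ.* 2) ℕ.+ k ≡ suc ((k ℕ.+ suc t) ℕ.* 2)
        split = solve-∀

  -- The two cases produce the two members of the maximum; whether some word is free of jokers is
  -- decidable.
  words-bound : ∀ {k N d} {w : Fin N → Word d} {q} → NeighborlyWords k w →
                ((∀ i → 1 ℕ.≤ stars (w i)) → fromℕ N ≤ q) →
                fromℕ N ≤ ∑₀ k (λ j → fromℕ (d C j)) ⊔ q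
  words-bound {k} {N} {d} {w} {q} nw star-bound with any? (λ i → stars (w i) ℕ.≟ 0)
  ... | yes (i , s≡0) =
    ≤-trans (subst (fromℕ N ≤_) (sym (∑₀-binomial d k)) (fromℕ-mono (star-free-bound nw i s≡0)))
            (p≤p⊔q (∑₀ k (λ j → fromℕ (d C j))) q)
  ... | no ∄ =
    ≤-trans (star-bound λ i → ℕ.n≢0⇒n>0 λ s≡0 → ∄ (i , s≡0))
            (p≤q⊔p (∑₀ k (λ j → fromℕ (d C j))) q)

  -- The order on ℝ is undecidable, but the bound itself is decidable, hence stable.
  boxes-bound : ∀ {k d q} →
    (∀ {N} {w : Fin N → Word d} → NeighborlyWords k w → (∀ i → 1 ℕ.≤ stars (w i)) → fromℕ N ≤ q) →
    n⟨ k , d ⟩≤ (∑₀ k (λ j → fromℕ (d C j)) ⊔ q)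
  boxes-bound star-bound N F neighborly = decidable-stable (_ ≤? _) λ N≰ →
    ¬¬touching? neighborly λ touching? →
      let w , nw = neighborlyWords neighborly touching? in N≰ (words-bound nw (star-bound nw))
    where open Boxes

-- The two parities of `d - k`.

theorem1p5 : (k d : ℕ) → 1 ℕ.≤ k → k ℕ.≤ d ℕ.∸ 1 →
    (2 ∣ (d ℕ.∸ k) →
    n⟨ k , d ⟩≤
    (∑₀ k (λ j → (+ (d C j)) ℚ./ 1)
    ⊔ (∑₁ ((d ℕ.∸ k ℕ.∸ 2) / 2)
    (λ j → (1/2^ (j ℕ.+ 1) - 1/2^ (d ℕ.∸ k ℕ.∸ j)) * ∣B∣ (k ℕ.+ 2 ℕ.* j) d)
    + 2^ ((d ℕ.+ k) / 2))))
    ×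
    (¬ (2 ∣ (d ℕ.∸ k)) →
    n⟨ k , d ⟩≤
    (∑₀ k (λ j → (+ (d C j)) ℚ./ 1)
    ⊔ (∑₁ ((d ℕ.∸ k ℕ.∸ 3) / 2)
    (λ j → (1/2^ (j ℕ.+ 1) - 1/2^ (d ℕ.∸ k ℕ.∸ j)) * ∣B∣ (k ℕ.+ 2 ℕ.* j) d)
    + 1/2^ ((d ℕ.∸ k ℕ.+ 1) / 2) * ∣B∣ (d ℕ.∸ 1) d
    + 2^ ((d ℕ.+ k ℕ.∸ 1) / 2))))
theorem1p5 k d 1≤k k≤d-1 = even , odd
  where
  open import Data.Nat using (suc)
  open import Data.Nat.Divisibility using (divides)
  open import Data.Nat.DivMod using (_%_; m≡m%n+[m/n]*n; m%n<n)
  open import Data.Nat.Properties using (m+[n∸m]≡n; m>n⇒m∸n≢0; <⇒≤)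
  open import Data.Product using (_,_)
  open import Relation.Binary.PropositionalEquality using (_≡_; sym)
  open import Relation.Nullary using (contradiction)
  open Bounds

  k<d : k ℕ.< d
  k<d = strict k≤d-1 1≤k
    where
    strict : ∀ {k d} → k ℕ.≤ d ℕ.∸ 1 → 1 ℕ.≤ k → k ℕ.< d
    strict {d = suc d} k≤d _ = ℕ.s≤s k≤d
    -- For `d = 0` truncation makes `d ∸ 1` equal to 0, so `k = 0`, against `1 ≤ k`.
    strict {d = 0} ℕ.z≤n ()

  d≡k+[d-k] : d ≡ k ℕ.+ (d ℕ.∸ k)
  d≡k+[d-k] = sym (m+[n∸m]≡n (<⇒≤ k<d))

  even : 2 ∣ (d ℕ.∸ k) → n⟨ k , d ⟩≤ _
  -- A zero quotient would mean `d ∸ k = 0`, which `k < d` excludes.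
  even (divides 0       d-k≡) = contradiction d-k≡ (m>n⇒m∸n≢0 k<d)
  even (divides (suc t) d-k≡) = boxes-bound λ nw 1≤s → star-bound-even nw 1≤s t (d ℕ.∸ k) d-k≡ d≡k+[d-k]

  odd : ¬ 2 ∣ (d ℕ.∸ k) → n⟨ k , d ⟩≤ _
  odd 2∤ = boxes-bound λ nw 1≤s → star-bound-odd nw 1≤s ((d ℕ.∸ k) / 2) (d ℕ.∸ k) remainder d≡k+[d-k]
    where
    remainder : d ℕ.∸ k ≡ suc ((d ℕ.∸ k) / 2 ℕ.* 2)
    remainder with (d ℕ.∸ k) % 2 | m≡m%n+[m/n]*n (d ℕ.∸ k) 2 | m%n<n (d ℕ.∸ k) 2
    ... | 0           | eq | _ = contradiction (divides ((d ℕ.∸ k) / 2) eq) 2∤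
    ... | 1           | eq | _ = eq
    ... | suc (suc _) | _  | ℕ.s≤s (ℕ.s≤s ())
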